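{- Let $n$ be a positive integer and let $G=K_n\times K_2$. Then $\mathcal{E}(G)=2\tau(G)$.
   Context: All graphs are finite, simple and undirected. The energy $\mathcal{E}(G)$ is the sum of the absolute values of all eigenvalues (with multiplicity) of the adjacency matrix $A(G)$. The vertex cover number $\tau(G)$ is the minimum cardinality of a set $X\subseteq V(G)$ such that every edge of $G$ has at least one endpoint in $X$. $K_n$ is the complete graph on $n$ vertices. Here $G\times H$ denotes the Cartesian product: the graph with vertex set $V(G)\times V(H)$ in which $(g_1,h_1)\sim(g_2,h_2)$ if and only if either $g_1=g_2$ and $h_1\sim h_2$, or $g_1\sim g_2$ and $h_1=h_2$. -}

module Defs where

open import Algebra.Bundles.Raw using (RawRing)
import Algebra.Definitions.RawMonoid as RawMonoidOps
import Algebra.Definitions.RawSemiring as RawSemiringOps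
open import Data.Bool.Base using (if_then_else_)
open import Data.Fin.Base using (Fin; zero; suc; toℕ; punchIn; remQuot)
open import Data.Fin.Properties using (_≟_; all?)
open import Data.Fin.Subset using (Subset; inside; outside; _∈_; ∣_∣)
open import Data.Fin.Subset.Properties using (_∈?_)
import Data.Integer.Base as ℤ
open import Data.List.Base using (List; []; _∷_; _++_; map; filter)
open import Data.List.Extrema.Nat using (min)
open import Data.Nat.Base as ℕ using (ℕ; zero; suc)
import Data.Nat.Properties as ℕ
open import Data.Product.Base using (∃-syntax; _×_; _,_; proj₁; proj₂)
open import Data.Rational.Base as ℚ using (ℚ; 0ℚ; 1ℚ; ½; Positive)
import Data.Rational.Properties as ℚ
open import Data.Rational.Solver using (module +-*-Solver)
open import Data.Sum.Base as Sum using (_⊎_; inj₁; inj₂)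
open import Data.Vec.Base using ([]; _∷_)
open import Data.Vec.Functional using (Vector)
open import Level using (0ℓ)
open import Relation.Binary.Core using (Rel)
open import Relation.Binary.Definitions using (Decidable; Symmetric; Irreflexive)
open import Relation.Binary.PropositionalEquality
  using (_≡_; _≢_; refl; sym; trans; cong; cong₂; subst; module ≡-Reasoning)
open import Relation.Nullary.Decidable as Dec
  using (Dec; does; ¬?; _×-dec_; _⊎-dec_; _→-dec_)

------------------------------------------------------------------------
-- Real numbers: Cauchy sequences of rationals, with equality modulo null
-- sequences.  The operations are pointwise.

IsCauchy : (ℕ → ℚ) → Set
IsCauchy x = ∀ ε → .{{Positive ε}} →
  ∃[ N ] (∀ m n → N ℕ.≤ m → N ℕ.≤ n → ℚ.∣ x m ℚ.- x n ∣ ℚ.< ε)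

record ℝ : Set where
  constructor mkℝ
  field
    seq    : ℕ → ℚ
    cauchy : IsCauchy seq

open ℝ public

infix 4 _≈_

_≈_ : Rel ℝ 0ℓ
x ≈ y = ∀ ε → .{{Positive ε}} →
  ∃[ N ] (∀ n → N ℕ.≤ n → ℚ.∣ seq x n ℚ.- seq y n ∣ ℚ.< ε)

private
  half-pos : ∀ ε → .{{Positive ε}} → Positive (ε ℚ.* ½)
  half-pos ε = ℚ.pos*pos⇒pos ε ½

  half+half : ∀ ε → ε ℚ.* ½ ℚ.+ ε ℚ.* ½ ≡ ε
  half+half ε = trans (sym (ℚ.*-distribˡ-+ ε ½ ½)) (ℚ.*-identityʳ ε)

  0<pos : ∀ ε → .{{Positive ε}} → 0ℚ ℚ.< ε
  0<pos ε = ℚ.positive⁻¹ ε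

  -- Past some index, a Cauchy sequence is bounded by a positive rational.
  eventually-bounded : ∀ x → IsCauchy x →
    ∃[ B ] Positive B × ∃[ N ] (∀ n → N ℕ.≤ n → ℚ.∣ x n ∣ ℚ.≤ B)
  eventually-bounded x cx with cx 1ℚ
  ... | N , close =
    1ℚ ℚ.+ ℚ.∣ x N ∣ , pos-B , N , λ n N≤n → begin
      ℚ.∣ x n ∣                        ≡⟨ cong ℚ.∣_∣ (split (x n) (x N)) ⟩
      ℚ.∣ (x n ℚ.- x N) ℚ.+ x N ∣      ≤⟨ ℚ.∣p+q∣≤∣p∣+∣q∣ (x n ℚ.- x N) (x N) ⟩
      ℚ.∣ x n ℚ.- x N ∣ ℚ.+ ℚ.∣ x N ∣  ≤⟨ ℚ.+-monoˡ-≤ ℚ.∣ x N ∣ (ℚ.<⇒≤ (close n N N≤n ℕ.≤-refl)) ⟩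
      1ℚ ℚ.+ ℚ.∣ x N ∣                 ∎
    where
    open ℚ.≤-Reasoning
    open +-*-Solver
    split : ∀ a b → a ≡ (a ℚ.- b) ℚ.+ b
    split = solve 2 (λ a b → a := (a :- b) :+ b) refl
    pos-B : Positive (1ℚ ℚ.+ ℚ.∣ x N ∣)
    pos-B = ℚ.positive (ℚ.+-mono-<-≤ (0<pos 1ℚ) (ℚ.0≤∣p∣ (x N)))

  const-cauchy : ∀ q → IsCauchy (λ _ → q)
  const-cauchy q ε = 0 , λ _ _ _ _ →
    subst (λ d → ℚ.∣ d ∣ ℚ.< ε) (sym (ℚ.+-inverseʳ q)) (0<pos ε)

  +-cauchy : ∀ x y → IsCauchy x → IsCauchy y → IsCauchy (λ n → x n ℚ.+ y n)
  +-cauchy x y cx cy ε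
    with cx (ε ℚ.* ½) {{half-pos ε}} | cy (ε ℚ.* ½) {{half-pos ε}}
  ... | M , x-close | N , y-close = M ℕ.⊔ N , λ m n ≤m ≤n → begin-strict
      ℚ.∣ (x m ℚ.+ y m) ℚ.- (x n ℚ.+ y n) ∣
        ≡⟨ cong ℚ.∣_∣ (regroup (x m) (y m) (x n) (y n)) ⟩
      ℚ.∣ (x m ℚ.- x n) ℚ.+ (y m ℚ.- y n) ∣
        ≤⟨ ℚ.∣p+q∣≤∣p∣+∣q∣ (x m ℚ.- x n) (y m ℚ.- y n) ⟩
      ℚ.∣ x m ℚ.- x n ∣ ℚ.+ ℚ.∣ y m ℚ.- y n ∣
        <⟨ ℚ.+-mono-< (x-close m n (ℕ.m⊔n≤o⇒m≤o M N ≤m) (ℕ.m⊔n≤o⇒m≤o M N ≤n))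
                      (y-close m n (ℕ.m⊔n≤o⇒n≤o M N ≤m) (ℕ.m⊔n≤o⇒n≤o M N ≤n)) ⟩
      ε ℚ.* ½ ℚ.+ ε ℚ.* ½
        ≡⟨ half+half ε ⟩
      ε ∎
    where
    open ℚ.≤-Reasoning
    open +-*-Solver
    regroup : ∀ a b c d → (a ℚ.+ b) ℚ.- (c ℚ.+ d) ≡ (a ℚ.- c) ℚ.+ (b ℚ.- d)
    regroup = solve 4 (λ a b c d → (a :+ b) :- (c :+ d) := (a :- c) :+ (b :- d)) refl

  neg-cauchy : ∀ x → IsCauchy x → IsCauchy (λ n → ℚ.- x n)
  neg-cauchy x cx ε with cx ε
  ... | N , close = N , λ m n ≤m ≤n →
    subst (ℚ._< ε)
      (trans (sym (ℚ.∣-p∣≡∣p∣ (x m ℚ.- x n)))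
             (cong ℚ.∣_∣ (ℚ.neg-distrib-+ (x m) (ℚ.- x n))))
      (close m n ≤m ≤n)

  *-regroup : ∀ a b c d →
    a ℚ.* b ℚ.- c ℚ.* d ≡ a ℚ.* (b ℚ.- d) ℚ.+ d ℚ.* (a ℚ.- c)
  *-regroup = solve 4 (λ a b c d →
    a :* b :- c :* d := a :* (b :- d) :+ d :* (a :- c)) refl
    where open +-*-Solver

  quotient : ∀ D → .{{Positive D}} → ∀ η → .{{Positive η}} →
    ∃[ δ ] Positive δ × D ℚ.* δ ≡ η
  quotient D η = 1/D ℚ.* η , ℚ.pos*pos⇒pos 1/D {{ℚ.1/pos⇒pos D}} η , (begin
    D ℚ.* (1/D ℚ.* η)  ≡⟨ sym (ℚ.*-assoc D 1/D η) ⟩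
    D ℚ.* 1/D ℚ.* η    ≡⟨ cong (ℚ._* η) (ℚ.*-inverseʳ D {{ℚ.pos⇒nonZero D}}) ⟩
    1ℚ ℚ.* η           ≡⟨ ℚ.*-identityˡ η ⟩
    η                  ∎)
    where
    open ≡-Reasoning
    1/D : ℚ
    1/D = (ℚ.1/ D) {{ℚ.pos⇒nonZero D}}

  ∣a*d∣<D*δ : ∀ D → .{{Positive D}} → ∀ δ a d →
    ℚ.∣ a ∣ ℚ.≤ D → ℚ.∣ d ∣ ℚ.< δ → ℚ.∣ a ℚ.* d ∣ ℚ.< D ℚ.* δ
  ∣a*d∣<D*δ D δ a d a≤D d<δ = begin-strict
    ℚ.∣ a ℚ.* d ∣        ≡⟨ ℚ.∣p*q∣≡∣p∣*∣q∣ a d ⟩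
    ℚ.∣ a ∣ ℚ.* ℚ.∣ d ∣  ≤⟨ ℚ.*-monoʳ-≤-nonNeg ℚ.∣ d ∣ {{ℚ.∣-∣-nonNeg d}} a≤D ⟩
    D ℚ.* ℚ.∣ d ∣        <⟨ ℚ.*-monoʳ-<-pos D d<δ ⟩
    D ℚ.* δ              ∎
    where open ℚ.≤-Reasoning

  *-close : ∀ B → .{{Positive B}} → ∀ C → .{{Positive C}} → ∀ β γ η {a b c d} →
    B ℚ.* β ≡ η → C ℚ.* γ ≡ η →
    ℚ.∣ a ∣ ℚ.≤ B → ℚ.∣ b ℚ.- d ∣ ℚ.< β →
    ℚ.∣ d ∣ ℚ.≤ C → ℚ.∣ a ℚ.- c ∣ ℚ.< γ →
    ℚ.∣ a ℚ.* b ℚ.- c ℚ.* d ∣ ℚ.< η ℚ.+ η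
  *-close B C β γ η {a} {b} {c} {d} Bβ≡η Cγ≡η a≤B b-d<β d≤C a-c<γ = begin-strict
    ℚ.∣ a ℚ.* b ℚ.- c ℚ.* d ∣
      ≡⟨ cong ℚ.∣_∣ (*-regroup a b c d) ⟩
    ℚ.∣ a ℚ.* (b ℚ.- d) ℚ.+ d ℚ.* (a ℚ.- c) ∣
      ≤⟨ ℚ.∣p+q∣≤∣p∣+∣q∣ (a ℚ.* (b ℚ.- d)) (d ℚ.* (a ℚ.- c)) ⟩
    ℚ.∣ a ℚ.* (b ℚ.- d) ∣ ℚ.+ ℚ.∣ d ℚ.* (a ℚ.- c) ∣
      <⟨ ℚ.+-mono-< (∣a*d∣<D*δ B β a (b ℚ.- d) a≤B b-d<β)
                    (∣a*d∣<D*δ C γ d (a ℚ.- c) d≤C a-c<γ) ⟩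
    B ℚ.* β ℚ.+ C ℚ.* γ
      ≡⟨ cong₂ ℚ._+_ Bβ≡η Cγ≡η ⟩
    η ℚ.+ η ∎
    where open ℚ.≤-Reasoning

  *-cauchy : ∀ x y → IsCauchy x → IsCauchy y → IsCauchy (λ n → x n ℚ.* y n)
  *-cauchy x y cx cy ε =
    let η                     = ε ℚ.* ½
        B , B>0 , K , x-bound = eventually-bounded x cx
        C , C>0 , L , y-bound = eventually-bounded y cy
        β , β>0 , Bβ≡η        = quotient B {{B>0}} η {{half-pos ε}}
        γ , γ>0 , Cγ≡η        = quotient C {{C>0}} η {{half-pos ε}}
        M , x-close           = cx γ {{γ>0}}
        N , y-close           = cy β {{β>0}}
        K⊔L≤ : ∀ {k} → (K ℕ.⊔ L) ℕ.⊔ (M ℕ.⊔ N) ℕ.≤ k → K ℕ.⊔ L ℕ.≤ k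
        K⊔L≤ = ℕ.m⊔n≤o⇒m≤o (K ℕ.⊔ L) (M ℕ.⊔ N)
        M⊔N≤ : ∀ {k} → (K ℕ.⊔ L) ℕ.⊔ (M ℕ.⊔ N) ℕ.≤ k → M ℕ.⊔ N ℕ.≤ k
        M⊔N≤ = ℕ.m⊔n≤o⇒n≤o (K ℕ.⊔ L) (M ℕ.⊔ N)
    in (K ℕ.⊔ L) ℕ.⊔ (M ℕ.⊔ N) , λ m n ≤m ≤n →
      subst (ℚ.∣ x m ℚ.* y m ℚ.- x n ℚ.* y n ∣ ℚ.<_) (half+half ε)
        (*-close B {{B>0}} C {{C>0}} β γ η Bβ≡η Cγ≡η
          (x-bound m (ℕ.m⊔n≤o⇒m≤o K L (K⊔L≤ ≤m)))
          (y-close m n (ℕ.m⊔n≤o⇒n≤o M N (M⊔N≤ ≤m)) (ℕ.m⊔n≤o⇒n≤o M N (M⊔N≤ ≤n)))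
          (y-bound n (ℕ.m⊔n≤o⇒n≤o K L (K⊔L≤ ≤n)))
          (x-close m n (ℕ.m⊔n≤o⇒m≤o M N (M⊔N≤ ≤m)) (ℕ.m⊔n≤o⇒m≤o M N (M⊔N≤ ≤n))))

  ∣∣a∣-∣b∣∣≤∣a-b∣ : ∀ a b → ℚ.∣ ℚ.∣ a ∣ ℚ.- ℚ.∣ b ∣ ∣ ℚ.≤ ℚ.∣ a ℚ.- b ∣
  ∣∣a∣-∣b∣∣≤∣a-b∣ a b with ℚ.∣p∣≡p∨∣p∣≡-p (ℚ.∣ a ∣ ℚ.- ℚ.∣ b ∣)
  ... | inj₁ eq = ℚ.≤-trans (ℚ.≤-reflexive eq) (one-sided a b)
    where
    open ℚ.≤-Reasoning
    open +-*-Solver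
    one-sided : ∀ a b → ℚ.∣ a ∣ ℚ.- ℚ.∣ b ∣ ℚ.≤ ℚ.∣ a ℚ.- b ∣
    one-sided a b = begin
      ℚ.∣ a ∣ ℚ.- ℚ.∣ b ∣
        ≡⟨ cong (λ c → ℚ.∣ c ∣ ℚ.- ℚ.∣ b ∣)
                (solve 2 (λ a b → a := (a :- b) :+ b) refl a b) ⟩
      ℚ.∣ (a ℚ.- b) ℚ.+ b ∣ ℚ.- ℚ.∣ b ∣
        ≤⟨ ℚ.+-monoˡ-≤ (ℚ.- ℚ.∣ b ∣) (ℚ.∣p+q∣≤∣p∣+∣q∣ (a ℚ.- b) b) ⟩
      ℚ.∣ a ℚ.- b ∣ ℚ.+ ℚ.∣ b ∣ ℚ.- ℚ.∣ b ∣
        ≡⟨ solve 2 (λ c d → c :+ d :- d := c) refl ℚ.∣ a ℚ.- b ∣ ℚ.∣ b ∣ ⟩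
      ℚ.∣ a ℚ.- b ∣ ∎
  ... | inj₂ eq = begin
      ℚ.∣ ℚ.∣ a ∣ ℚ.- ℚ.∣ b ∣ ∣
        ≡⟨ eq ⟩
      ℚ.- (ℚ.∣ a ∣ ℚ.- ℚ.∣ b ∣)
        ≡⟨ solve 2 (λ c d → :- (c :- d) := d :- c) refl ℚ.∣ a ∣ ℚ.∣ b ∣ ⟩
      ℚ.∣ b ∣ ℚ.- ℚ.∣ a ∣
        ≡⟨ cong (λ c → ℚ.∣ c ∣ ℚ.- ℚ.∣ a ∣)
                (solve 2 (λ a b → b := :- (a :- b) :+ a) refl a b) ⟩
      ℚ.∣ ℚ.- (a ℚ.- b) ℚ.+ a ∣ ℚ.- ℚ.∣ a ∣
        ≤⟨ ℚ.+-monoˡ-≤ (ℚ.- ℚ.∣ a ∣) (ℚ.∣p+q∣≤∣p∣+∣q∣ (ℚ.- (a ℚ.- b)) a) ⟩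
      ℚ.∣ ℚ.- (a ℚ.- b) ∣ ℚ.+ ℚ.∣ a ∣ ℚ.- ℚ.∣ a ∣
        ≡⟨ solve 2 (λ c d → c :+ d :- d := c) refl ℚ.∣ ℚ.- (a ℚ.- b) ∣ ℚ.∣ a ∣ ⟩
      ℚ.∣ ℚ.- (a ℚ.- b) ∣
        ≡⟨ ℚ.∣-p∣≡∣p∣ (a ℚ.- b) ⟩
      ℚ.∣ a ℚ.- b ∣ ∎
    where
    open ℚ.≤-Reasoning
    open +-*-Solver

  abs-cauchy : ∀ x → IsCauchy x → IsCauchy (λ n → ℚ.∣ x n ∣)
  abs-cauchy x cx ε with cx ε
  ... | N , close = N , λ m n ≤m ≤n →
    ℚ.≤-<-trans (∣∣a∣-∣b∣∣≤∣a-b∣ (x m) (x n)) (close m n ≤m ≤n)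

fromℚ : ℚ → ℝ
fromℚ q = mkℝ (λ _ → q) (const-cauchy q)

fromℕ : ℕ → ℝ
fromℕ k = fromℚ (ℤ.+ k ℚ./ 1)

infixl 6 _+_ _-_
infixl 7 _*_
infix  8 -_

_+_ : ℝ → ℝ → ℝ
x + y = mkℝ (λ n → seq x n ℚ.+ seq y n) (+-cauchy (seq x) (seq y) (cauchy x) (cauchy y))

_*_ : ℝ → ℝ → ℝ
x * y = mkℝ (λ n → seq x n ℚ.* seq y n) (*-cauchy (seq x) (seq y) (cauchy x) (cauchy y))

-_ : ℝ → ℝ
- x = mkℝ (λ n → ℚ.- seq x n) (neg-cauchy (seq x) (cauchy x))

_-_ : ℝ → ℝ → ℝ
x - y = x + (- y)

abs : ℝ → ℝ
abs x = mkℝ (λ n → ℚ.∣ seq x n ∣) (abs-cauchy (seq x) (cauchy x))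

ℝ-rawRing : RawRing 0ℓ 0ℓ
ℝ-rawRing = record
  { Carrier = ℝ
  ; _≈_     = _≈_
  ; _+_     = _+_
  ; _*_     = _*_
  ; -_      = -_
  ; 0#      = fromℚ 0ℚ
  ; 1#      = fromℚ 1ℚ
  }

------------------------------------------------------------------------
-- Determinants and spectra

module _ {c ℓ} (R : RawRing c ℓ) where
  private module R = RawRing R
  open RawMonoidOps R.+-rawMonoid using (sum)
  open RawSemiringOps R.rawSemiring using (_^_)

  -- Laplace expansion along the first row.
  det : ∀ {n} → (Fin n → Fin n → R.Carrier) → R.Carrier
  det {zero}  M = R.1#
  det {suc n} M = sum λ j →
    ((R.- R.1#) ^ toℕ j) R.* M zero j R.* det (λ i k → M (suc i) (punchIn j k))

Matrix : ℕ → Set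
Matrix n = Fin n → Fin n → ℝ

∑ : ∀ {n} → Vector ℝ n → ℝ
∑ = RawMonoidOps.sum (RawRing.+-rawMonoid ℝ-rawRing)

∏ : ∀ {n} → Vector ℝ n → ℝ
∏ = RawMonoidOps.sum (RawRing.*-rawMonoid ℝ-rawRing)

𝟙 : ∀ {n} → Matrix n
𝟙 i j = if does (i ≟ j) then fromℚ 1ℚ else fromℚ 0ℚ

charPoly : ∀ {n} → Matrix n → ℝ → ℝ
charPoly A x = det ℝ-rawRing (λ i j → x * 𝟙 i j - A i j)

-- `es` lists all eigenvalues of A with multiplicity: det (xI − A) splits as
-- ∏ᵢ (x − esᵢ).  Since ℝ is infinite, agreement at every real x is the same
-- as equality of polynomials.
IsSpectrum : ∀ {n} → Matrix n → Vector ℝ n → Set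
IsSpectrum A es = ∀ x → charPoly A x ≈ ∏ (λ i → x - es i)

------------------------------------------------------------------------
-- Graphs

record Graph : Set₁ where
  field
    order  : ℕ
    Adj    : Rel (Fin order) 0ℓ
    adj?   : Decidable Adj
    symm   : Symmetric Adj
    irrefl : Irreflexive _≡_ Adj

open Graph public

adjacency : (G : Graph) → Matrix (order G)
adjacency G i j = if does (adj? G i j) then fromℚ 1ℚ else fromℚ 0ℚ

-- The energy as a functional relation (up to _≈_): the eigenvalue list is
-- determined by the adjacency matrix up to reordering.
IsEnergy : Graph → ℝ → Set
IsEnergy G e = ∃[ es ] IsSpectrum (adjacency G) es × e ≈ ∑ (λ i → abs (es i))

IsVertexCover : (G : Graph) → Subset (order G) → Set
IsVertexCover G X = ∀ i j → Adj G i j → i ∈ X ⊎ j ∈ X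

isVertexCover? : (G : Graph) → (X : Subset (order G)) → Dec (IsVertexCover G X)
isVertexCover? G X =
  all? λ i → all? λ j → adj? G i j →-dec (i ∈? X ⊎-dec j ∈? X)

subsets : ∀ n → List (Subset n)
subsets zero    = [] ∷ []
subsets (suc n) = map (inside ∷_) (subsets n) ++ map (outside ∷_) (subsets n)

-- The default value `order G` of `min` is harmless: it is the size of the
-- cover consisting of all vertices.
τ : Graph → ℕ
τ G = min (order G) (map ∣_∣ (filter (isVertexCover? G) (subsets (order G))))

K : ℕ → Graph
K n = record
  { order  = n
  ; Adj    = _≢_
  ; adj?   = λ i j → ¬? (i ≟ j)
  ; symm   = λ i≢j j≡i → i≢j (sym j≡i)
  ; irrefl = λ i≡j i≢j → i≢j i≡j
  }

-- The vertex set V(G) × V(H) is identified with Fin (order G * order H)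
-- through the bijection `remQuot`.
infixl 7 _□_

_□_ : Graph → Graph → Graph
G □ H = record
  { order  = order G ℕ.* order H
  ; Adj    = λ u v → Adj′ (vertex u) (vertex v)
  ; adj?   = λ u v → adj′? (vertex u) (vertex v)
  ; symm   = Sum.map
      (λ (g≡ , h~) → sym g≡ , symm H h~)
      (λ (g~ , h≡) → symm G g~ , sym h≡)
  ; irrefl = λ { refl (inj₁ (_ , h~)) → irrefl H refl h~
               ; refl (inj₂ (g~ , _)) → irrefl G refl g~ }
  }
  where
  V : Set
  V = Fin (order G) × Fin (order H)

  vertex : Fin (order G ℕ.* order H) → V
  vertex = remQuot (order H)

  Adj′ : Rel V 0ℓ
  Adj′ (g₁ , h₁) (g₂ , h₂) = (g₁ ≡ g₂ × Adj H h₁ h₂) ⊎ (Adj G g₁ g₂ × h₁ ≡ h₂)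

  adj′? : Decidable Adj′
  adj′? (g₁ , h₁) (g₂ , h₂) =
    (g₁ ≟ g₂ ×-dec adj? H h₁ h₂) ⊎-dec (adj? G g₁ g₂ ×-dec h₁ ≟ h₂)

{-# OPTIONS --safe #-}
module Submission where

-- The indicator vectors of the two layers of K n □ K 2 span an invariant subspace of the
-- adjacency matrix with eigenvalues n and n − 2.  Replacing the first two columns of xI − A by
-- a basis of this subspace factors (x − n)(x − n + 2) out of the determinant; adding multiples
-- of them to the other columns then clears everything outside 2×2 diagonal blocks of
-- determinant x (x + 2).  So the spectrum is n, n − 2, 0ⁿ⁻¹, (−2)ⁿ⁻¹ and the energy is 4(n − 1) for n ≥ 2.
-- A vertex cover misses at most one vertex of each of the two complete layers, and for n ≥ 2
-- these can be chosen nonadjacent, so τ = 2(n − 1).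
-- All entries are rational, and real arithmetic is pointwise on Cauchy sequences, so the
-- determinant is computed over ℚ.

open import Defs
  using ( ℝ; seq; fromℚ; fromℕ; abs; ℝ-rawRing; det; Matrix; ∑; ∏; 𝟙; charPoly; IsSpectrum
        ; Graph; order; Adj; adj?; symm; irrefl; adjacency; IsEnergy
        ; IsVertexCover; isVertexCover?; subsets; τ; K; _□_ )
import Defs as ℝ using (_≈_; _*_; _-_; -_)
open import Data.Nat.Base using (ℕ; zero; suc; NonZero)

open import Algebra.Bundles using (CommutativeRing; Semiring)
open import Algebra.Bundles.Raw using (RawMonoid; RawRing)
import Algebra.Definitions.RawMonoid as RawMonoidOps
import Algebra.Definitions.RawSemiring as RawSemiringOps
open import Data.Bool.Base using (true; false; if_then_else_)
open import Data.Fin.Base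
  using (Fin; zero; suc; toℕ; inject₁; fromℕ<; punchIn; punchOut; quotient; remainder; combine)
open import Data.Fin.Properties
  using ( _≟_; suc-injective; punchIn-injective; punchInᵢ≢i; punchIn-punchOut
        ; toℕ-injective; toℕ-inject₁; toℕ<n; toℕ-fromℕ<; remQuot-combine )
open import Data.Fin.Subset using (Subset; inside; outside; _∈_; ⊤) renaming (∣_∣ to ∣_∣ˢ)
open import Data.Fin.Subset.Properties using (drop-there; ∈⊤; ∣⊤∣≡n; p⊆q⇒∣p∣≤∣q∣)
import Data.Integer.Base as ℤ
import Data.Integer.Properties as ℤ
open import Data.List.Base using (map)
open import Data.List.Extrema.Nat using (min≤v⁺; v≤min⁺)
open import Data.List.Membership.Propositional using () renaming (_∈_ to _∈ˡ_)
open import Data.List.Membership.Propositional.Properties using (∈-++⁺ˡ; ∈-++⁺ʳ; ∈-map⁺; ∈-filter⁺)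
import Data.List.Relation.Unary.All as All
import Data.List.Relation.Unary.All.Properties as All
import Data.List.Relation.Unary.Any as Any
import Data.Nat.Base as ℕ
open import Data.Nat.Coprimality as Coprime using (Coprime; 1-coprimeTo)
import Data.Nat.Properties as ℕ
open import Data.Product.Base using (∃-syntax; _×_; _,_; proj₁; proj₂)
open import Data.Rational.Base as ℚ using (ℚ; 0ℚ; 1ℚ)
import Data.Rational.Properties as ℚ
open import Data.Rational.Solver using () renaming (module +-*-Solver to ℚ-Solver)
open import Data.Sum.Base as Sum using (_⊎_; inj₁; inj₂)
open import Data.Vec.Base using ([]; _∷_; tabulate; lookup; here; there)
open import Data.Vec.Functional using (Vector; removeAt)
open import Data.Vec.Properties using (lookup⇒[]=; []=⇒lookup; lookup∘tabulate)
open import Function.Base using (_∘_)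
open import Relation.Binary.Definitions using (tri<; tri≈; tri>)
open import Relation.Binary.PropositionalEquality as ≡ using (_≡_; _≢_)
open import Relation.Nullary.Decidable using (does; yes; no; dec-true; dec-false)
open import Relation.Nullary.Negation using (¬_; contradiction)

-- Determinants over a commutative ring: multilinearity and alternation in the columns.

-- Keeps two equal adjacent columns adjacent in every minor that retains both, as the induction in
-- `adjacent-columns⇒0` requires.
punchIn-adjacent : ∀ {n} (j : Fin (suc (suc n))) (i : Fin (suc n)) →
  j ≢ inject₁ i → j ≢ suc i →
  ∃[ i′ ] punchIn j (inject₁ i′) ≡ inject₁ i × punchIn j (suc i′) ≡ suc i
punchIn-adjacent zero zero j≢i _ = contradiction ≡.refl j≢i
punchIn-adjacent zero (suc i) _ _ = i , ≡.refl , ≡.refl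
punchIn-adjacent (suc zero) zero _ j≢i+1 = contradiction ≡.refl j≢i+1
punchIn-adjacent {suc n} (suc (suc j)) zero _ _ = zero , ≡.refl , ≡.refl
punchIn-adjacent {suc n} (suc j) (suc i) j≢i j≢i+1 =
  let i′ , p , q = punchIn-adjacent j i (j≢i ∘ ≡.cong suc) (j≢i+1 ∘ ≡.cong suc)
  in suc i′ , ≡.cong suc p , ≡.cong suc q

module Determinant {c ℓ} (R : CommutativeRing c ℓ) where
  open CommutativeRing R hiding (zero)
  open import Algebra.Definitions.RawSemiring (Semiring.rawSemiring semiring) using (_^_)
  open import Algebra.Properties.Semiring.Sum semiring
  open import Algebra.Properties.Ring ring using (-‿distribˡ-*; -1*x≈-x)
  open import Algebra.Solver.Ring.NaturalCoefficients.Default commutativeSemiring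
  open import Relation.Binary.Reasoning.Setoid setoid

  Mat : ℕ → Set c
  Mat n = Fin n → Fin n → Carrier

  ∣_∣ : ∀ {n} → Mat n → Carrier
  ∣_∣ = det rawRing

  minor : ∀ {n} → Mat (suc n) → Fin (suc n) → Mat n
  minor M j i k = M (suc i) (punchIn j k)

  sgn : ∀ {n} → Fin n → Carrier
  sgn j = (- 1#) ^ toℕ j

  cofactor : ∀ {n} → Mat (suc n) → Fin (suc n) → Carrier
  cofactor M j = sgn j * M zero j * ∣ minor M j ∣

  sum-cong : ∀ {n} {f g : Vector Carrier n} → (∀ i → f i ≈ g i) → sum f ≈ sum g
  sum-cong = sum-cong-≋

  sum-zero : ∀ {n} {f : Vector Carrier n} → (∀ i → f i ≈ 0#) → sum f ≈ 0#
  sum-zero {n} f≈0 = trans (sum-cong f≈0) (sum-replicate-zero n)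

  sum-single : ∀ {n} (f : Vector Carrier n) k → (∀ j → j ≢ k → f j ≈ 0#) → sum f ≈ f k
  sum-single {suc n} f k f≈0 = begin
    sum f                     ≈⟨ sum-remove f ⟩
    f k + sum (removeAt f k)  ≈⟨ +-congˡ (sum-zero (λ j → f≈0 _ (punchInᵢ≢i k j))) ⟩
    f k + 0#                  ≈⟨ +-identityʳ _ ⟩
    f k                       ∎

  sum-adjacent : ∀ {n} (f : Vector Carrier (suc n)) (i : Fin n) →
    (∀ j → j ≢ inject₁ i → j ≢ suc i → f j ≈ 0#) → sum f ≈ f (inject₁ i) + f (suc i)
  sum-adjacent f zero f≈0 = begin
    f zero + (f (suc zero) + sum (λ j → f (suc (suc j))))
      ≈⟨ +-congˡ (+-congˡ (sum-zero (λ j → f≈0 (suc (suc j)) (λ ()) (λ ())))) ⟩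
    f zero + (f (suc zero) + 0#)
      ≈⟨ +-congˡ (+-identityʳ _) ⟩
    f zero + f (suc zero) ∎
  sum-adjacent f (suc i) f≈0 = begin
    f zero + sum (f ∘ suc)
      ≈⟨ +-cong (f≈0 zero (λ ()) (λ ()))
           (sum-adjacent (f ∘ suc) i λ j p q → f≈0 (suc j) (λ { ≡.refl → p ≡.refl }) λ { ≡.refl → q ≡.refl }) ⟩
    0# + (f (inject₁ (suc i)) + f (suc (suc i)))
      ≈⟨ +-identityˡ _ ⟩
    f (inject₁ (suc i)) + f (suc (suc i)) ∎

  det-cong : ∀ {n} {M N : Mat n} → (∀ i j → M i j ≈ N i j) → ∣ M ∣ ≈ ∣ N ∣
  det-cong {zero}  M≈N = refl
  det-cong {suc n} M≈N = sum-cong λ j →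
    *-cong (*-congˡ {sgn j} (M≈N zero j)) (det-cong λ i k → M≈N (suc i) (punchIn j k))

  -- In the expansion along the first row, the term at `k` is linear through its entry, and its
  -- minors agree because they omit column `k`. Every other term has a fixed entry and a minor that
  -- is linear by induction.
  det-linear : ∀ {n} k a {M A B : Mat n} →
    (∀ i → M i k ≈ a * A i k + B i k) →
    (∀ i j → j ≢ k → A i j ≈ M i j) → (∀ i j → j ≢ k → B i j ≈ M i j) →
    ∣ M ∣ ≈ a * ∣ A ∣ + ∣ B ∣
  det-linear {suc n} k a {M} {A} {B} M≈ A≈ B≈ = begin
    ∣ M ∣                                          ≈⟨ sum-cong term ⟩
    sum (λ j → a * cofactor A j + cofactor B j)    ≈⟨ ∑-distrib-+ (λ j → a * cofactor A j) (cofactor B) ⟩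
    sum (λ j → a * cofactor A j) + ∣ B ∣           ≈⟨ +-congʳ (*-distribˡ-sum a (cofactor A)) ⟨
    a * ∣ A ∣ + ∣ B ∣                              ∎
    where
    term : ∀ j → cofactor M j ≈ a * cofactor A j + cofactor B j
    term j with j ≟ k
    ... | yes ≡.refl = begin
      sgn j * M zero j * ∣ minor M j ∣
        ≈⟨ *-congʳ (*-congˡ (M≈ zero)) ⟩
      sgn j * (a * A zero j + B zero j) * ∣ minor M j ∣
        ≈⟨ solve 5 (λ s a x y d → s :* (a :* x :+ y) :* d := a :* (s :* x :* d) :+ s :* y :* d)
             refl (sgn j) a (A zero j) (B zero j) _ ⟩
      a * (sgn j * A zero j * ∣ minor M j ∣) + sgn j * B zero j * ∣ minor M j ∣
        ≈⟨ +-cong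
             (*-congˡ (*-congˡ (det-cong λ i l → A≈ (suc i) _ (punchInᵢ≢i j l))))
             (*-congˡ (det-cong λ i l → B≈ (suc i) _ (punchInᵢ≢i j l))) ⟨
      a * cofactor A j + cofactor B j ∎
    ... | no j≢k = begin
      sgn j * M zero j * ∣ minor M j ∣
        ≈⟨ *-congˡ (det-linear k′ a
             (λ i → ≡.subst (λ l → M (suc i) l ≈ a * A (suc i) l + B (suc i) l) (≡.sym k≡) (M≈ (suc i)))
             (λ i l l≢k′ → A≈ (suc i) _ (≢k l≢k′))
             (λ i l l≢k′ → B≈ (suc i) _ (≢k l≢k′))) ⟩
      sgn j * M zero j * (a * ∣ minor A j ∣ + ∣ minor B j ∣)
        ≈⟨ solve 5 (λ s m a x y → s :* m :* (a :* x :+ y) := a :* (s :* m :* x) :+ s :* m :* y)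
             refl (sgn j) (M zero j) a _ _ ⟩
      a * (sgn j * M zero j * ∣ minor A j ∣) + sgn j * M zero j * ∣ minor B j ∣
        ≈⟨ +-cong (*-congˡ (*-congʳ (*-congˡ (A≈ zero j j≢k)))) (*-congʳ (*-congˡ (B≈ zero j j≢k))) ⟨
      a * cofactor A j + cofactor B j ∎
      where
      k′ : Fin n
      k′ = punchOut j≢k
      k≡ : punchIn j k′ ≡ k
      k≡ = punchIn-punchOut j≢k
      ≢k : ∀ {l} → l ≢ k′ → punchIn j l ≢ k
      ≢k l≢k′ eq = l≢k′ (punchIn-injective j _ _ (≡.trans eq (≡.sym k≡)))

  -- Makes the two minors that delete one of two equal adjacent columns coincide.
  punchIn-swap : ∀ {n} (i : Fin n) (v : Vector Carrier (suc n)) →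
    v (inject₁ i) ≈ v (suc i) → ∀ k → v (punchIn (inject₁ i) k) ≈ v (punchIn (suc i) k)
  punchIn-swap zero    v eq zero    = sym eq
  punchIn-swap zero    v eq (suc k) = refl
  punchIn-swap (suc i) v eq zero    = refl
  punchIn-swap (suc i) v eq (suc k) = punchIn-swap i (v ∘ suc) eq k

  -- Minors that keep both columns vanish by induction. The two remaining cofactors have equal
  -- entries and equal minors but opposite signs, so they cancel.
  adjacent-columns⇒0 : ∀ {n} (M : Mat (suc n)) (i : Fin n) →
    (∀ r → M r (inject₁ i) ≈ M r (suc i)) → ∣ M ∣ ≈ 0#
  adjacent-columns⇒0 {suc n} M i eq = begin
    ∣ M ∣
      ≈⟨ sum-adjacent _ i other ⟩
    sgn (inject₁ i) * M zero (inject₁ i) * ∣ minor M (inject₁ i) ∣ + - 1# * sgn i * M zero (suc i) * ∣ minor M (suc i) ∣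
      ≈⟨ +-cong (*-cong (*-cong (reflexive (≡.cong ((- 1#) ^_) (toℕ-inject₁ i))) (eq zero))
                        (det-cong λ r → punchIn-swap i (M (suc r)) (eq (suc r))))
           (trans (*-congʳ (*-assoc _ _ _)) (trans (*-assoc _ _ _) (-1*x≈-x _))) ⟩
    sgn i * M zero (suc i) * ∣ minor M (suc i) ∣ + - (sgn i * M zero (suc i) * ∣ minor M (suc i) ∣)
      ≈⟨ -‿inverseʳ _ ⟩
    0# ∎
    where
    other : ∀ j → j ≢ inject₁ i → j ≢ suc i → sgn j * M zero j * ∣ minor M j ∣ ≈ 0#
    other j j≢i j≢i+1 =
      let i′ , p , q = punchIn-adjacent j i j≢i j≢i+1
      in trans (*-congˡ (adjacent-columns⇒0 (minor M j) i′ λ r →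
                 ≡.subst₂ (λ x y → M (suc r) x ≈ M (suc r) y) (≡.sym p) (≡.sym q) (eq (suc r))))
               (zeroʳ _)

  -- Replacing columns and column operations.

  _[_≔_] : ∀ {n} → Mat n → Fin n → Vector Carrier n → Mat n
  (M [ k ≔ v ]) i j = if does (j ≟ k) then v i else M i j

  ≔-here : ∀ {n} (M : Mat n) k v i → (M [ k ≔ v ]) i k ≡ v i
  ≔-here M k v i rewrite dec-true (k ≟ k) ≡.refl = ≡.refl

  ≔-there : ∀ {n} (M : Mat n) {k} v i {j} → j ≢ k → (M [ k ≔ v ]) i j ≡ M i j
  ≔-there M {k} v i {j} j≢k rewrite dec-false (j ≟ k) j≢k = ≡.refl

  det-≔-linear : ∀ {n} (M : Mat n) k a v w →
    ∣ M [ k ≔ (λ i → a * v i + w i) ] ∣ ≈ a * ∣ M [ k ≔ v ] ∣ + ∣ M [ k ≔ w ] ∣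
  det-≔-linear M k a v w = det-linear k a
    (λ i → trans (reflexive (≔-here M k (λ r → a * v r + w r) i))
             (sym (+-cong (*-congˡ (reflexive (≔-here M k v i))) (reflexive (≔-here M k w i)))))
    (λ i j j≢k → reflexive (≡.trans (≔-there M v i j≢k) (≡.sym (≔-there M (λ r → a * v r + w r) i j≢k))))
    (λ i j j≢k → reflexive (≡.trans (≔-there M w i j≢k) (≡.sym (≔-there M (λ r → a * v r + w r) i j≢k))))

  ≔-comm : ∀ {n} (M : Mat n) {k l} v w → k ≢ l → ∀ i j →
    ((M [ k ≔ v ]) [ l ≔ w ]) i j ≡ ((M [ l ≔ w ]) [ k ≔ v ]) i j
  ≔-comm M {k} {l} v w k≢l i j with j ≟ k | j ≟ l
  ... | yes ≡.refl | yes ≡.refl = contradiction ≡.refl k≢l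
  ... | yes ≡.refl | no _       = ≡.refl
  ... | no _       | yes ≡.refl = ≡.refl
  ... | no _       | no _       = ≡.refl

  ≔-cong : ∀ {n} (M N : Mat n) k v → (∀ i → v i ≈ N i k) → (∀ i j → j ≢ k → M i j ≈ N i j) →
    ∀ i j → (M [ k ≔ v ]) i j ≈ N i j
  ≔-cong M N k v v≈ M≈N i j with j ≟ k
  ... | yes ≡.refl = v≈ i
  ... | no j≢k     = M≈N i j j≢k

  private
    equal-columns-at-distance : ∀ d {n} (M : Mat n) k l → toℕ l ≡ suc (d ℕ.+ toℕ k) →
      (∀ r → M r k ≈ M r l) → ∣ M ∣ ≈ 0#
    equal-columns-at-distance zero M k (suc i) l≡1+k eq =
      adjacent-columns⇒0 M i λ r → ≡.subst (λ j → M r j ≈ M r (suc i)) k≡i (eq r)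
      where
      k≡i : k ≡ inject₁ i
      k≡i = toℕ-injective (≡.sym (≡.trans (toℕ-inject₁ i) (ℕ.suc-injective l≡1+k)))
    -- With v = M r k and w the column just left of l, the vanishing determinant
    -- with v + w in both of the adjacent positions expands into four terms, of
    -- which all but |M| vanish.
    equal-columns-at-distance (suc d) {suc n} M k (suc i) l≡ eq = begin
      ∣ M ∣                                        ≈⟨ det-cong M≈P ⟩
      q w v                                        ≈⟨ pad (q w v) ⟩
      1# * (1# * 0# + 0#) + (1# * q w v + 0#)      ≈⟨ +-cong (*-congˡ (+-cong (*-congˡ (adj v)) (far w))) (+-congˡ (adj w)) ⟨
      1# * (1# * q v v + q v w) + (1# * q w v + q w w)
        ≈⟨ +-cong (*-congˡ (linearʳ v)) (linearʳ w) ⟨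
      1# * q v v+w + q w v+w                       ≈⟨ linearˡ v+w ⟨
      q v+w v+w                                    ≈⟨ adj v+w ⟩
      0#                                           ∎
      where
      m l : Fin (suc n)
      m = inject₁ i
      l = suc i
      m≡ : toℕ m ≡ suc (d ℕ.+ toℕ k)
      m≡ = ≡.trans (toℕ-inject₁ i) (ℕ.suc-injective l≡)
      m≢l : m ≢ l
      m≢l m≡l = ℕ.1+n≢n (≡.trans (≡.sym (≡.cong toℕ m≡l)) (toℕ-inject₁ i))
      k≢l : k ≢ l
      k≢l k≡l = ℕ.m≢1+n+m (toℕ k) (≡.trans (≡.cong toℕ k≡l) l≡)
      k≢m : k ≢ m
      k≢m k≡m = ℕ.m≢1+n+m (toℕ k) (≡.trans (≡.cong toℕ k≡m) m≡)

      v w v+w : Vector Carrier (suc n)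
      v r = M r k
      w r = M r m
      v+w r = 1# * v r + w r

      P : (x y : Vector Carrier (suc n)) → Mat (suc n)
      P x y = (M [ m ≔ x ]) [ l ≔ y ]
      q : (x y : Vector Carrier (suc n)) → Carrier
      q x y = ∣ P x y ∣

      P-m : ∀ x y r → P x y r m ≡ x r
      P-m x y r = ≡.trans (≔-there (M [ m ≔ x ]) y r m≢l) (≔-here M m x r)
      P-l : ∀ x y r → P x y r l ≡ y r
      P-l x y r = ≔-here (M [ m ≔ x ]) l y r
      P-k : ∀ x y r → P x y r k ≡ v r
      P-k x y r = ≡.trans (≔-there (M [ m ≔ x ]) y r k≢l) (≔-there M x r k≢m)

      M≈P : ∀ r j → M r j ≈ P w v r j
      M≈P r j = sym (≔-cong _ M l v eq (λ r j _ → ≔-cong M M m w (λ _ → refl) (λ _ _ _ → refl) r j) r j)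
      adj : ∀ x → q x x ≈ 0#
      adj x = adjacent-columns⇒0 (P x x) i λ r → reflexive (≡.trans (P-m x x r) (≡.sym (P-l x x r)))
      far : ∀ y → q v y ≈ 0#
      far y = equal-columns-at-distance d (P v y) k m m≡ λ r →
        reflexive (≡.trans (P-k v y r) (≡.sym (P-m v y r)))
      linearʳ : ∀ x → q x v+w ≈ 1# * q x v + q x w
      linearʳ x = det-≔-linear (M [ m ≔ x ]) l 1# v w
      flip : ∀ x y → q x y ≈ ∣ (M [ l ≔ y ]) [ m ≔ x ] ∣
      flip x y = det-cong λ r j → reflexive (≔-comm M x y m≢l r j)
      linearˡ : ∀ y → q v+w y ≈ 1# * q v y + q w y
      linearˡ y = trans (flip v+w y) (trans (det-≔-linear (M [ l ≔ y ]) m 1# v w)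
        (sym (+-cong (*-congˡ (flip v y)) (flip w y))))
      pad : ∀ x → x ≈ 1# * (1# * 0# + 0#) + (1# * x + 0#)
      pad = solve 1 (λ x → x := con 1 :* (con 1 :* con 0 :+ con 0) :+ (con 1 :* x :+ con 0)) refl

    distance : ∀ {i j} → i ℕ.< j → j ≡ suc ((j ℕ.∸ suc i) ℕ.+ i)
    distance {i} {j} i<j = ≡.trans (≡.sym (ℕ.m∸n+n≡m i<j)) (ℕ.+-suc (j ℕ.∸ suc i) i)

  equal-columns⇒0 : ∀ {n} (M : Mat n) {k l} → k ≢ l → (∀ r → M r k ≈ M r l) → ∣ M ∣ ≈ 0#
  equal-columns⇒0 M {k} {l} k≢l eq with ℕ.<-cmp (toℕ k) (toℕ l)
  ... | tri≈ _ k≡l _ = contradiction (toℕ-injective k≡l) k≢l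
  ... | tri< k<l _ _ = equal-columns-at-distance _ M k l (distance k<l) eq
  ... | tri> _ _ l<k = equal-columns-at-distance _ M l k (distance l<k) (sym ∘ eq)

  -- A zero column is -1 times itself plus itself, so linearity gives -|M| + |M|.
  zero-column⇒0 : ∀ {n} (M : Mat n) k → (∀ r → M r k ≈ 0#) → ∣ M ∣ ≈ 0#
  zero-column⇒0 M k M≈0 = begin
    ∣ M ∣               ≈⟨ det-linear k (- 1#) col (λ _ _ _ → refl) (λ _ _ _ → refl) ⟩
    - 1# * ∣ M ∣ + ∣ M ∣  ≈⟨ +-congʳ (-1*x≈-x _) ⟩
    - ∣ M ∣ + ∣ M ∣       ≈⟨ -‿inverseˡ _ ⟩
    0#                  ∎
    where
    col : ∀ r → M r k ≈ - 1# * M r k + M r k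
    col r = trans (M≈0 r) (sym (trans (+-congʳ (-1*x≈-x _)) (-‿inverseˡ _)))

  det-≔-sum : ∀ {n p} (M : Mat n) k (a : Vector Carrier p) (C : Fin p → Vector Carrier n) →
    ∣ M [ k ≔ (λ r → sum λ l → a l * C l r) ] ∣ ≈ sum (λ l → a l * ∣ M [ k ≔ C l ] ∣)
  det-≔-sum {p = zero}  M k a C = zero-column⇒0 _ k λ r → reflexive (≔-here M k (λ _ → 0#) r)
  det-≔-sum {p = suc p} M k a C =
    trans (det-≔-linear M k (a zero) (C zero) (λ r → sum λ l → a (suc l) * C (suc l) r))
          (+-congˡ (det-≔-sum M k (a ∘ suc) (C ∘ suc)))

  -- Replace column `k` by the combination of all columns with coefficients `a` and expand by
  -- linearity: only the term at `k` survives, since each other term repeats a column. When the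
  -- combination is an eigenvector times a scalar `d`, this trades a column for the eigenvector and
  -- pulls `d` out.
  cramer : ∀ {n} {M N : Mat n} k (a : Vector Carrier n) d →
    (∀ i j → j ≢ k → N i j ≈ M i j) →
    (∀ i → sum (λ l → a l * M i l) ≈ d * N i k) →
    a k * ∣ M ∣ ≈ d * ∣ N ∣
  cramer {n} {M} {N} k a d N≈M combination = begin
    a k * ∣ M ∣
      ≈⟨ *-congˡ (det-cong (≔-cong M M k (col k) (λ _ → refl) (λ _ _ _ → refl))) ⟨
    a k * ∣ M [ k ≔ col k ] ∣
      ≈⟨ sum-single (λ l → a l * ∣ M [ k ≔ col l ] ∣) k others ⟨
    sum (λ l → a l * ∣ M [ k ≔ col l ] ∣)
      ≈⟨ det-≔-sum M k a col ⟨
    ∣ M [ k ≔ (λ r → sum λ l → a l * M r l) ] ∣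
      ≈⟨ det-linear k d {A = N} {B = M [ k ≔ (λ _ → 0#) ]}
           (λ i → begin
             (M [ k ≔ (λ r → sum λ l → a l * M r l) ]) i k
               ≡⟨ ≔-here M k (λ r → sum λ l → a l * M r l) i ⟩
             sum (λ l → a l * M i l)
               ≈⟨ combination i ⟩
             d * N i k
               ≈⟨ +-identityʳ _ ⟨
             d * N i k + 0#
               ≡⟨ ≡.cong (d * N i k +_) (≔-here M k (λ _ → 0#) i) ⟨
             d * N i k + (M [ k ≔ (λ _ → 0#) ]) i k ∎)
           (λ i j j≢k → trans (N≈M i j j≢k) (sym (reflexive (≔-there M (λ r → sum λ l → a l * M r l) i j≢k))))
           (λ i j j≢k → reflexive (≡.trans (≔-there M (λ _ → 0#) i j≢k) (≡.sym (≔-there M (λ r → sum λ l → a l * M r l) i j≢k)))) ⟩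
    d * ∣ N ∣ + ∣ M [ k ≔ (λ _ → 0#) ] ∣
      ≈⟨ +-congˡ (zero-column⇒0 _ k λ r → reflexive (≔-here M k (λ _ → 0#) r)) ⟩
    d * ∣ N ∣ + 0#
      ≈⟨ +-identityʳ _ ⟩
    d * ∣ N ∣ ∎
    where
    col : Fin n → Vector Carrier n
    col l r = M r l
    others : ∀ l → l ≢ k → a l * ∣ M [ k ≔ col l ] ∣ ≈ 0#
    others l l≢k = trans (*-congˡ (equal-columns⇒0 (M [ k ≔ col l ]) l≢k λ r →
      reflexive (≡.trans (≔-there M (col l) r l≢k) (≡.sym (≔-here M k (col l) r))))) (zeroʳ _)

  -- By linearity the change is `b` times a determinant in which column `k` occurs twice.
  add-column : ∀ {n} {M N : Mat n} {j k} b → j ≢ k →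
    (∀ i → N i j ≈ M i j + b * M i k) → (∀ i l → l ≢ j → N i l ≈ M i l) → ∣ N ∣ ≈ ∣ M ∣
  add-column {n} {M} {N} {j} {k} b j≢k N-j N≈M = begin
    ∣ N ∣
      ≈⟨ det-linear j b {A = A} {B = M}
           (λ i → trans (N-j i) (trans (+-comm _ _) (sym (+-congʳ (*-congˡ (reflexive (≔-here M j (λ r → M r k) i)))))))
           (λ i l l≢j → trans (reflexive (≔-there M (λ r → M r k) i l≢j)) (sym (N≈M i l l≢j)))
           (λ i l l≢j → sym (N≈M i l l≢j)) ⟩
    b * ∣ A ∣ + ∣ M ∣
      ≈⟨ +-congʳ (*-congˡ (equal-columns⇒0 A j≢k λ r →
           reflexive (≡.trans (≔-here M j (λ r → M r k) r) (≡.sym (≔-there M (λ r → M r k) r (j≢k ∘ ≡.sym)))))) ⟩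
    b * 0# + ∣ M ∣
      ≈⟨ trans (+-congʳ (zeroʳ b)) (+-identityˡ _) ⟩
    ∣ M ∣ ∎
    where
    A : Mat n
    A = M [ j ≔ (λ i → M i k) ]

  add-columns : ∀ {n} {M N : Mat n} k (b : Vector Carrier n) → b k ≈ 0# →
    (∀ i j → N i j ≈ M i j + b j * M i k) → ∣ N ∣ ≈ ∣ M ∣
  add-columns {n} {M} k b bk≈0 N≈ = go n ℕ.≤-refl b bk≈0 (λ j n≤j → contradiction (toℕ<n j) (ℕ.≤⇒≯ n≤j)) N≈
    where
    -- Induction on `t`, where `b` is supported on the columns of index below `t`; each round clears
    -- the last coefficient. Since `b k` is zero, the pivot column stays the same throughout.
    go : ∀ t → t ℕ.≤ n → ∀ {N : Mat n} (b : Vector Carrier n) → b k ≈ 0# →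
      (∀ j → t ℕ.≤ toℕ j → b j ≈ 0#) →
      (∀ i j → N i j ≈ M i j + b j * M i k) → ∣ N ∣ ≈ ∣ M ∣
    go zero _ b _ b≈0 N≈ = det-cong λ i j →
      trans (N≈ i j) (trans (+-congˡ (trans (*-congʳ (b≈0 j ℕ.z≤n)) (zeroˡ _))) (+-identityʳ _))
    go (suc t) t<n {N} b bk≈0 b≈0 N≈ = trans step (go t (ℕ.<⇒≤ t<n) b′ b′k≈0 b′≈0 (λ _ _ → refl))
      where
      f : Fin n
      f = fromℕ< t<n
      b′ : Vector Carrier n
      b′ j = if does (j ≟ f) then 0# else b j
      N′ : Mat n
      N′ i j = M i j + b′ j * M i k
      b′k≈0 : b′ k ≈ 0#
      b′k≈0 with k ≟ f
      ... | yes _ = refl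
      ... | no _  = bk≈0
      b′≈0 : ∀ j → t ℕ.≤ toℕ j → b′ j ≈ 0#
      b′≈0 j t≤j with j ≟ f
      ... | yes _  = refl
      ... | no j≢f = b≈0 j (ℕ.≤∧≢⇒< t≤j λ t≡j →
        j≢f (toℕ-injective (≡.trans (≡.sym t≡j) (≡.sym (toℕ-fromℕ< t<n)))))
      N≈N′ : ∀ i j → j ≢ f → N i j ≈ N′ i j
      N≈N′ i j j≢f rewrite dec-false (j ≟ f) j≢f = N≈ i j
      N′-k : ∀ i → N′ i k ≈ M i k
      N′-k i = trans (+-congˡ (trans (*-congʳ b′k≈0) (zeroˡ _))) (+-identityʳ _)
      N-f : ∀ i → N i f ≈ N′ i f + b f * N′ i k
      N-f i rewrite dec-true (f ≟ f) ≡.refl =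
        trans (N≈ i f) (+-cong (sym (trans (+-congˡ (zeroˡ _)) (+-identityʳ _))) (*-congˡ (sym (N′-k i))))
      step : ∣ N ∣ ≈ ∣ N′ ∣
      step with f ≟ k
      ... | no f≢k = add-column (b f) f≢k N-f N≈N′
      -- The coefficient being cleared is the one at the pivot, which is already zero.
      ... | yes f≡k = det-cong same
        where
        same : ∀ i j → N i j ≈ N′ i j
        same i j with j ≟ f
        ... | no j≢f     = N≈ i j
        ... | yes ≡.refl = trans (N≈ i j) (+-congˡ (*-congʳ (trans (reflexive (≡.cong b f≡k)) bk≈0)))

  det-lower-triangular-step : ∀ {n} (M : Mat (suc n)) → (∀ j → M zero (suc j) ≈ 0#) →
    ∣ M ∣ ≈ M zero zero * ∣ minor M zero ∣
  det-lower-triangular-step M M≈0 = trans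
    (sum-single (cofactor M) zero λ { zero 0≢0 → contradiction ≡.refl 0≢0
                                    ; (suc j) _ → trans (*-congʳ (trans (*-congˡ (M≈0 j)) (zeroʳ _))) (zeroˡ _) })
    (*-congʳ (*-identityˡ _))

-- The characteristic determinant of the prism over ℚ.

-- The matrix qI - A over ℚ, to which the matrix in `charPoly` reduces at each index of the Cauchy
-- sequences.
charMatrix : (G : Graph) → ℚ → Fin (order G) → Fin (order G) → ℚ
charMatrix G q i j = q ℚ.* (if does (i ≟ j) then 1ℚ else 0ℚ) ℚ.- (if does (adj? G i j) then 1ℚ else 0ℚ)

module Prism (x : ℚ) where
  open Determinant ℚ.+-*-commutativeRing
  open import Algebra.Definitions.RawMonoid ℚ.+-0-rawMonoid using () renaming (_×_ to _×ℚ_)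
  open import Algebra.Properties.Semiring.Sum (CommutativeRing.semiring ℚ.+-*-commutativeRing)
    using (sum; ∑-distrib-+; *-distribˡ-sum)
  open ≡.≡-Reasoning
  open ℚ-Solver

  δ : ∀ {n} → Fin n → Fin n → ℚ
  δ i j = if does (i ≟ j) then 1ℚ else 0ℚ

  -- Vertex (i, h) has index 2i + h, so this is the parity of the index, and matching on two
  -- successors peels off one vertex of `K n` with both of its copies.
  layer : ∀ n → Fin (n ℕ.* 2) → Fin 2
  layer n = remainder {n} 2

  xI-A : ∀ n → Mat (n ℕ.* 2)
  xI-A n = charMatrix (K n □ K 2) x

  blocks : ∀ n → Mat (n ℕ.* 2)
  blocks n i j =
    if does (quotient {n} 2 i ≟ quotient {n} 2 j)
    then (if does (layer n i ≟ layer n j) then x ℚ.+ 1ℚ else ℚ.- 1ℚ)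
    else 0ℚ

  -- Write J for the all-ones matrix and P for the swap of the two vertices of `K 2`. Then A = J ⊗ I
  -- - I + I ⊗ P. Here `blocks` is (x + 1)I - I ⊗ P, which is block diagonal, and the `δ` of the
  -- layers is J ⊗ I.
  xI-A≡blocks : ∀ n i j → xI-A n i j ≡ blocks n i j ℚ.- δ (layer n i) (layer n j)
  xI-A≡blocks (suc n) = entry
    where
    same : x ℚ.* 1ℚ ℚ.- 0ℚ ≡ x ℚ.+ 1ℚ ℚ.- 1ℚ
    same = solve 1 (λ x → x :* con 1ℚ :- con 0ℚ := x :+ con 1ℚ :- con 1ℚ) ≡.refl x
    partner : x ℚ.* 0ℚ ℚ.- 1ℚ ≡ ℚ.- 1ℚ ℚ.- 0ℚ
    partner = solve 1 (λ x → x :* con 0ℚ :- con 1ℚ := con (ℚ.- 1ℚ) :- con 0ℚ) ≡.refl x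
    other : ∀ d → x ℚ.* 0ℚ ℚ.- d ≡ 0ℚ ℚ.- d
    other = solve 2 (λ x d → x :* con 0ℚ :- d := con 0ℚ :- d) ≡.refl x

    entry : ∀ i j → xI-A (suc n) i j ≡ blocks (suc n) i j ℚ.- δ (layer (suc n) i) (layer (suc n) j)
    entry zero          zero          = same
    entry zero          (suc zero)    = partner
    entry zero          (suc (suc j)) = other (δ zero (layer n j))
    entry (suc zero)    zero          = partner
    entry (suc zero)    (suc zero)    = same
    entry (suc zero)    (suc (suc j)) = other (δ (suc zero) (layer n j))
    entry (suc (suc i)) zero          = other (δ (layer n i) zero)
    entry (suc (suc i)) (suc zero)    = other (δ (layer n i) (suc zero))
    entry (suc (suc i)) (suc (suc j)) = xI-A≡blocks n i j

  module _ (α : Fin 2 → ℚ) where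
    α₀ α₁ : ℚ
    α₀ = α zero
    α₁ = α (suc zero)

    -- On a vector constant on each layer, with value y in the layer of `i` and y′ in the other, the
    -- row gives (x + 1)y - y′. It is written (x + 2)y - (y + y′) so that the other layer need not
    -- be named.
    ∑-blocks : ∀ n i → sum (λ l → α (layer n l) ℚ.* blocks n i l) ≡
      (x ℚ.+ (1ℚ ℚ.+ 1ℚ)) ℚ.* α (layer n i) ℚ.- (α₀ ℚ.+ α₁)
    ∑-blocks (suc n) = row
      where
      rest≡0 : sum (λ l → α (layer n l) ℚ.* 0ℚ) ≡ 0ℚ
      rest≡0 = sum-zero λ l → ℚ.*-zeroʳ (α (layer n l))

      row : ∀ i → sum (λ l → α (layer (suc n) l) ℚ.* blocks (suc n) i l) ≡
        (x ℚ.+ (1ℚ ℚ.+ 1ℚ)) ℚ.* α (layer (suc n) i) ℚ.- (α₀ ℚ.+ α₁)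
      row zero = ≡.trans (≡.cong (λ s → α₀ ℚ.* (x ℚ.+ 1ℚ) ℚ.+ (α₁ ℚ.* (ℚ.- 1ℚ) ℚ.+ s)) rest≡0)
        (solve 3 (λ x a b → a :* (x :+ con 1ℚ) :+ (b :* con (ℚ.- 1ℚ) :+ con 0ℚ)
                         := (x :+ (con 1ℚ :+ con 1ℚ)) :* a :- (a :+ b)) ≡.refl x α₀ α₁)
      row (suc zero) = ≡.trans (≡.cong (λ s → α₀ ℚ.* (ℚ.- 1ℚ) ℚ.+ (α₁ ℚ.* (x ℚ.+ 1ℚ) ℚ.+ s)) rest≡0)
        (solve 3 (λ x a b → a :* con (ℚ.- 1ℚ) :+ (b :* (x :+ con 1ℚ) :+ con 0ℚ)
                         := (x :+ (con 1ℚ :+ con 1ℚ)) :* b :- (a :+ b)) ≡.refl x α₀ α₁)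
      row (suc (suc i)) = ≡.trans
        (solve 3 (λ a b s → a :* con 0ℚ :+ (b :* con 0ℚ :+ s) := s) ≡.refl α₀ α₁ _)
        (∑-blocks n i)

    -- J ⊗ I acts as multiplication by n on vectors constant on each layer.
    ∑-δ : ∀ n h → sum (λ l → α (layer n l) ℚ.* δ h (layer n l)) ≡ (n ×ℚ 1ℚ) ℚ.* α h
    ∑-δ zero    h = ≡.sym (ℚ.*-zeroˡ (α h))
    ∑-δ (suc n) h = ≡.trans
      (≡.cong (λ s → α₀ ℚ.* δ h zero ℚ.+ (α₁ ℚ.* δ h (suc zero) ℚ.+ s)) (∑-δ n h))
      (pair h)
      where
      pair : ∀ h → α₀ ℚ.* δ h zero ℚ.+ (α₁ ℚ.* δ h (suc zero) ℚ.+ (n ×ℚ 1ℚ) ℚ.* α h) ≡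
        (1ℚ ℚ.+ n ×ℚ 1ℚ) ℚ.* α h
      pair zero = solve 3 (λ a b c → a :* con 1ℚ :+ (b :* con 0ℚ :+ c :* a) := (con 1ℚ :+ c) :* a)
        ≡.refl α₀ α₁ (n ×ℚ 1ℚ)
      pair (suc zero) = solve 3 (λ a b c → a :* con 0ℚ :+ (b :* con 1ℚ :+ c :* b) := (con 1ℚ :+ c) :* b)
        ≡.refl α₀ α₁ (n ×ℚ 1ℚ)

    -- For α = (1, 1) the right side is x - n. For α = (0, 1) it is (x - n + 2)α minus the all-ones
    -- vector, which is the form used for the second eigenvalue.
    ∑-xI-A : ∀ n i → sum (λ l → α (layer n l) ℚ.* xI-A n i l) ≡
      (x ℚ.- (n ×ℚ 1ℚ ℚ.- (1ℚ ℚ.+ 1ℚ))) ℚ.* α (layer n i) ℚ.- (α₀ ℚ.+ α₁)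
    ∑-xI-A n i = begin
      sum (λ l → a l ℚ.* xI-A n i l)
        ≡⟨ sum-cong (λ l → ≡.trans (≡.cong (a l ℚ.*_) (xI-A≡blocks n i l))
             (solve 3 (λ a b d → a :* (b :- d) := a :* b :+ con (ℚ.- 1ℚ) :* (a :* d))
               ≡.refl (a l) (blocks n i l) (d l))) ⟩
      sum (λ l → a l ℚ.* blocks n i l ℚ.+ ℚ.- 1ℚ ℚ.* (a l ℚ.* d l))
        ≡⟨ ∑-distrib-+ (λ l → a l ℚ.* blocks n i l) (λ l → ℚ.- 1ℚ ℚ.* (a l ℚ.* d l)) ⟩
      sum (λ l → a l ℚ.* blocks n i l) ℚ.+ sum (λ l → ℚ.- 1ℚ ℚ.* (a l ℚ.* d l))
        ≡⟨ ≡.cong₂ ℚ._+_ (∑-blocks n i)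
             (≡.trans (≡.sym (*-distribˡ-sum (ℚ.- 1ℚ) (λ l → a l ℚ.* d l)))
                      (≡.cong (ℚ.- 1ℚ ℚ.*_) (∑-δ n (layer n i)))) ⟩
      (x ℚ.+ (1ℚ ℚ.+ 1ℚ)) ℚ.* α (layer n i) ℚ.- (α₀ ℚ.+ α₁) ℚ.+ ℚ.- 1ℚ ℚ.* ((n ×ℚ 1ℚ) ℚ.* α (layer n i))
        ≡⟨ solve 4 (λ x y s c → (x :+ (con 1ℚ :+ con 1ℚ)) :* y :- s :+ con (ℚ.- 1ℚ) :* (c :* y)
                             := (x :- (c :- (con 1ℚ :+ con 1ℚ))) :* y :- s)
             ≡.refl x (α (layer n i)) (α₀ ℚ.+ α₁) (n ×ℚ 1ℚ) ⟩
      (x ℚ.- (n ×ℚ 1ℚ ℚ.- (1ℚ ℚ.+ 1ℚ))) ℚ.* α (layer n i) ℚ.- (α₀ ℚ.+ α₁) ∎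
      where
      a d : Vector ℚ (n ℕ.* 2)
      a l = α (layer n l)
      d l = δ (layer n i) (layer n l)

  -- The leading block has determinant (x + 1)² - 1 = x(x + 2). The factor x stays in the form x - 0
  -- to match the product over the eigenvalues.
  det-blocks : ∀ n → ∣ blocks (suc n) ∣ ≡ (x ℚ.- 0ℚ) ℚ.* ((x ℚ.+ (1ℚ ℚ.+ 1ℚ)) ℚ.* ∣ blocks n ∣)
  det-blocks n = begin
    ∣ B ∣
      ≡⟨ sum-adjacent (cofactor B) zero (λ { zero p _ → contradiction ≡.refl p
                                            ; (suc zero) _ p → contradiction ≡.refl p
                                            ; (suc (suc j)) _ _ → vanish (sgn (suc (suc j))) ∣ minor B (suc (suc j)) ∣ }) ⟩
    1ℚ ℚ.* (x ℚ.+ 1ℚ) ℚ.* ∣ minor B zero ∣ ℚ.+ ℚ.- 1ℚ ℚ.* 1ℚ ℚ.* (ℚ.- 1ℚ) ℚ.* ∣ minor B (suc zero) ∣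
      ≡⟨ ≡.cong₂ (λ p q → 1ℚ ℚ.* (x ℚ.+ 1ℚ) ℚ.* p ℚ.+ ℚ.- 1ℚ ℚ.* 1ℚ ℚ.* (ℚ.- 1ℚ) ℚ.* q)
           (det-lower-triangular-step (minor B zero) (λ _ → ≡.refl))
           (det-lower-triangular-step (minor B (suc zero)) (λ _ → ≡.refl)) ⟩
    1ℚ ℚ.* (x ℚ.+ 1ℚ) ℚ.* ((x ℚ.+ 1ℚ) ℚ.* ∣ blocks n ∣) ℚ.+
      ℚ.- 1ℚ ℚ.* 1ℚ ℚ.* (ℚ.- 1ℚ) ℚ.* (ℚ.- 1ℚ ℚ.* ∣ blocks n ∣)
      ≡⟨ solve 2 (λ x d → con 1ℚ :* (x :+ con 1ℚ) :* ((x :+ con 1ℚ) :* d)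
                          :+ con (ℚ.- 1ℚ) :* con 1ℚ :* con (ℚ.- 1ℚ) :* (con (ℚ.- 1ℚ) :* d)
                       := (x :- con 0ℚ) :* ((x :+ (con 1ℚ :+ con 1ℚ)) :* d))
           ≡.refl x ∣ blocks n ∣ ⟩
    (x ℚ.- 0ℚ) ℚ.* ((x ℚ.+ (1ℚ ℚ.+ 1ℚ)) ℚ.* ∣ blocks n ∣) ∎
    where
    B : Mat (suc n ℕ.* 2)
    B = blocks (suc n)
    vanish : ∀ s d → s ℚ.* 0ℚ ℚ.* d ≡ 0ℚ
    vanish = solve 2 (λ s d → s :* con 0ℚ :* d := con 0ℚ) ≡.refl

  det-xI-A : ∀ m → let c = suc m ×ℚ 1ℚ in
    ∣ xI-A (suc m) ∣ ≡ (x ℚ.- c) ℚ.* ((x ℚ.- (c ℚ.- (1ℚ ℚ.+ 1ℚ))) ℚ.* ∣ blocks m ∣)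
  det-xI-A m = begin
    ∣ L ∣                         ≡⟨ ℚ.*-identityˡ ∣ L ∣ ⟨
    1ℚ ℚ.* ∣ L ∣                  ≡⟨ cramer zero (λ _ → 1ℚ) d₁ L≡N₁ combination₁ ⟩
    d₁ ℚ.* ∣ N₁ ∣                 ≡⟨ ≡.cong (d₁ ℚ.*_) (ℚ.*-identityˡ ∣ N₁ ∣) ⟨
    d₁ ℚ.* (1ℚ ℚ.* ∣ N₁ ∣)        ≡⟨ ≡.cong (d₁ ℚ.*_) (cramer {M = N₁} {N = N₂} (suc zero) a₂ d₂ N₁≡N₂ combination₂) ⟩
    d₁ ℚ.* (d₂ ℚ.* ∣ N₂ ∣)        ≡⟨ ≡.cong (λ d → d₁ ℚ.* (d₂ ℚ.* d)) (≡.sym det-N₂) ⟩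
    d₁ ℚ.* (d₂ ℚ.* ∣ blocks m ∣)  ∎
    where
    n : ℕ
    n = suc m
    c d₁ d₂ : ℚ
    c  = n ×ℚ 1ℚ
    d₁ = x ℚ.- c
    d₂ = x ℚ.- (c ℚ.- (1ℚ ℚ.+ 1ℚ))
    L : Mat (n ℕ.* 2)
    L = xI-A n
    upper : Fin 2 → ℚ
    upper = δ (suc zero)
    a₂ : Vector ℚ (n ℕ.* 2)
    -- The first column of `N₁` is all ones, so this coefficient cancels the -1 left over by
    -- `∑-xI-A` for `upper`.
    a₂ zero    = 1ℚ
    a₂ (suc l) = upper (layer n (suc l))
    -- The coefficients in `δ-span`: adding these multiples of the first two columns cancels J ⊗ I
    -- in all later columns. They vanish at the first two positions to leave the pivots intact.
    b₃ b₄ : Vector ℚ (n ℕ.* 2)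
    b₃ zero          = 0ℚ
    b₃ (suc zero)    = 0ℚ
    b₃ (suc (suc j)) = δ zero (layer m j)
    b₄ zero          = 0ℚ
    b₄ (suc zero)    = 0ℚ
    b₄ (suc (suc j)) = upper (layer m j) ℚ.- δ zero (layer m j)

    N₁ N₂ N₃ N₄ : Mat (n ℕ.* 2)
    N₁ i zero          = 1ℚ
    N₁ i (suc j)       = L i (suc j)
    N₂ i zero          = 1ℚ
    N₂ i (suc zero)    = upper (layer n i)
    N₂ i (suc (suc j)) = L i (suc (suc j))
    N₃ i j = N₂ i j ℚ.+ b₃ j ℚ.* N₂ i zero
    N₄ i zero          = 1ℚ
    N₄ i (suc zero)    = upper (layer n i)
    N₄ i (suc (suc j)) = blocks n i (suc (suc j))

    L≡N₁ : ∀ i j → j ≢ zero → N₁ i j ≡ L i j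
    L≡N₁ i zero    0≢0 = contradiction ≡.refl 0≢0
    L≡N₁ i (suc j) _   = ≡.refl

    combination₁ : ∀ i → sum (λ l → 1ℚ ℚ.* L i l) ≡ d₁ ℚ.* 1ℚ
    combination₁ i = ≡.trans (∑-xI-A (λ _ → 1ℚ) n i)
      (solve 2 (λ x c → (x :- (c :- (con 1ℚ :+ con 1ℚ))) :* con 1ℚ :- (con 1ℚ :+ con 1ℚ)
                     := (x :- c) :* con 1ℚ) ≡.refl x c)

    N₁≡N₂ : ∀ i j → j ≢ suc zero → N₂ i j ≡ N₁ i j
    N₁≡N₂ i zero          _   = ≡.refl
    N₁≡N₂ i (suc zero)    1≢1 = contradiction ≡.refl 1≢1
    N₁≡N₂ i (suc (suc j)) _   = ≡.refl

    combination₂ : ∀ i → sum (λ l → a₂ l ℚ.* N₁ i l) ≡ d₂ ℚ.* upper (layer n i)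
    combination₂ i = begin
      1ℚ ℚ.* 1ℚ ℚ.+ rest
        ≡⟨ solve 2 (λ r l → con 1ℚ :* con 1ℚ :+ r := con 0ℚ :* l :+ r :+ con 1ℚ) ≡.refl rest (L i zero) ⟩
      0ℚ ℚ.* L i zero ℚ.+ rest ℚ.+ 1ℚ
        ≡⟨ ≡.cong (ℚ._+ 1ℚ) (∑-xI-A upper n i) ⟩
      d₂ ℚ.* upper (layer n i) ℚ.- (0ℚ ℚ.+ 1ℚ) ℚ.+ 1ℚ
        ≡⟨ solve 1 (λ y → y :- (con 0ℚ :+ con 1ℚ) :+ con 1ℚ := y) ≡.refl (d₂ ℚ.* upper (layer n i)) ⟩
      d₂ ℚ.* upper (layer n i) ∎
      where
      rest : ℚ
      rest = sum (λ l → upper (layer n (suc l)) ℚ.* L i (suc l))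

    -- As δ 0 g = 1 − δ 1 g, every column δ (layer i) h is a combination of the first two columns of N₂.
    δ-span : ∀ g h → δ g h ≡ δ zero h ℚ.+ (upper h ℚ.- δ zero h) ℚ.* upper g
    δ-span zero       zero       = ≡.refl
    δ-span zero       (suc zero) = ≡.refl
    δ-span (suc zero) zero       = ≡.refl
    δ-span (suc zero) (suc zero) = ≡.refl

    pad : ∀ p q r → p ℚ.+ 0ℚ ℚ.* q ℚ.+ 0ℚ ℚ.* r ≡ p
    pad = solve 3 (λ p q r → p :+ con 0ℚ :* q :+ con 0ℚ :* r := p) ≡.refl

    N₄≡ : ∀ i j → N₄ i j ≡ N₃ i j ℚ.+ b₄ j ℚ.* N₃ i (suc zero)
    N₄≡ i zero          = ≡.sym (pad 1ℚ 1ℚ (N₃ i (suc zero)))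
    N₄≡ i (suc zero)    = ≡.sym (pad (upper (layer n i)) 1ℚ (N₃ i (suc zero)))
    N₄≡ i (suc (suc j)) = begin
      w
        ≡⟨ solve 2 (λ w d → w := w :- d :+ d) ≡.refl w (δ g h) ⟩
      w ℚ.- δ g h ℚ.+ δ g h
        ≡⟨ ≡.cong₂ ℚ._+_ (≡.sym (xI-A≡blocks n i (suc (suc j)))) (δ-span g h) ⟩
      L i (suc (suc j)) ℚ.+ (δ zero h ℚ.+ (upper h ℚ.- δ zero h) ℚ.* upper g)
        ≡⟨ solve 4 (λ l p q u → l :+ (p :+ q :* u) := l :+ p :* con 1ℚ :+ q :* (u :+ con 0ℚ :* con 1ℚ))
             ≡.refl (L i (suc (suc j))) (δ zero h) (upper h ℚ.- δ zero h) (upper g) ⟩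
      N₃ i (suc (suc j)) ℚ.+ b₄ (suc (suc j)) ℚ.* N₃ i (suc zero) ∎
      where
      g h : Fin 2
      g = layer n i
      h = layer m j
      w : ℚ
      w = blocks n i (suc (suc j))

    det-N₂ : ∣ blocks m ∣ ≡ ∣ N₂ ∣
    det-N₂ = begin
      ∣ blocks m ∣
        ≡⟨ ℚ.*-identityˡ ∣ blocks m ∣ ⟨
      1ℚ ℚ.* ∣ blocks m ∣
        -- The first two rows of `N₄` are (1, 0, 0, ...) and (1, 1, 0, ...), because `blocks`
        -- vanishes outside the diagonal blocks; removing them with the first two columns leaves
        -- `blocks m`.
        ≡⟨ det-lower-triangular-step (minor N₄ zero) (λ _ → ≡.refl) ⟨
      ∣ minor N₄ zero ∣
        ≡⟨ ℚ.*-identityˡ ∣ minor N₄ zero ∣ ⟨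
      1ℚ ℚ.* ∣ minor N₄ zero ∣
        ≡⟨ det-lower-triangular-step N₄ (λ { zero → ≡.refl ; (suc _) → ≡.refl }) ⟨
      ∣ N₄ ∣
        ≡⟨ add-columns {M = N₃} {N = N₄} (suc zero) b₄ ≡.refl N₄≡ ⟩
      ∣ N₃ ∣
        ≡⟨ add-columns {M = N₂} {N = N₃} zero b₃ ≡.refl (λ _ _ → ≡.refl) ⟩
      ∣ N₂ ∣ ∎

-- The vertex cover number of the prism.

-- The first vertex outside the cover forces every later vertex into it.
complete-cover-size : ∀ n (X : Subset n) → IsVertexCover (K n) X → n ℕ.≤ suc ∣ X ∣ˢ
complete-cover-size zero    X             cover = ℕ.z≤n
complete-cover-size (suc n) (inside ∷ X)  cover = ℕ.s≤s (complete-cover-size n X λ i j i≢j →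
  Sum.map drop-there drop-there (cover (suc i) (suc j) (i≢j ∘ suc-injective)))
complete-cover-size (suc n) (outside ∷ X) cover = ℕ.s≤s
  (≡.subst (ℕ._≤ ∣ X ∣ˢ) (∣⊤∣≡n n) (p⊆q⇒∣p∣≤∣q∣ {p = ⊤} λ {i} _ → full i))
  where
  full : ∀ i → i ∈ X
  full i with cover zero (suc i) (λ ())
  ... | inj₂ i∈X = drop-there i∈X

layer-subset : ∀ n → Fin 2 → Subset (n ℕ.* 2) → Subset n
layer-subset n h X = tabulate λ i → lookup X (combine i h)

∣layers∣ : ∀ n (X : Subset (n ℕ.* 2)) →
  ∣ layer-subset n zero X ∣ˢ ℕ.+ ∣ layer-subset n (suc zero) X ∣ˢ ≡ ∣ X ∣ˢ
∣layers∣ zero    []                      = ≡.refl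
∣layers∣ (suc n) (inside  ∷ inside  ∷ X) = ≡.cong suc (≡.trans (ℕ.+-suc _ _) (≡.cong suc (∣layers∣ n X)))
∣layers∣ (suc n) (inside  ∷ outside ∷ X) = ≡.cong suc (∣layers∣ n X)
∣layers∣ (suc n) (outside ∷ inside  ∷ X) = ≡.trans (ℕ.+-suc _ _) (≡.cong suc (∣layers∣ n X))
∣layers∣ (suc n) (outside ∷ outside ∷ X) = ∣layers∣ n X

-- Each layer carries a copy of `K n`, whose edges the cover must meet within that layer.
layer-cover : ∀ n h (X : Subset (n ℕ.* 2)) → IsVertexCover (K n □ K 2) X →
  IsVertexCover (K n) (layer-subset n h X)
layer-cover n h X cover i j i≢j = Sum.map ∈-layer ∈-layer (cover (combine i h) (combine j h) adjacent)
  where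
  ∈-layer : ∀ {i} → combine i h ∈ X → i ∈ layer-subset n h X
  ∈-layer {i} i∈X = lookup⇒[]= i _ (≡.trans (lookup∘tabulate _ i) ([]=⇒lookup i∈X))
  adjacent : Adj (K n □ K 2) (combine i h) (combine j h)
  adjacent = inj₂
    ( (λ eq → i≢j (≡.trans (≡.sym (≡.cong proj₁ (remQuot-combine i h)))
                           (≡.trans eq (≡.cong proj₁ (remQuot-combine j h)))))
    , ≡.trans (≡.cong proj₂ (remQuot-combine i h)) (≡.sym (≡.cong proj₂ (remQuot-combine j h))) )

prism-cover-size : ∀ m (X : Subset (suc m ℕ.* 2)) → IsVertexCover (K (suc m) □ K 2) X → m ℕ.* 2 ℕ.≤ ∣ X ∣ˢ
prism-cover-size m X cover = begin
  m ℕ.* 2                                 ≡⟨ ℕ.*-comm m 2 ⟩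
  m ℕ.+ (m ℕ.+ 0)                         ≡⟨ ≡.cong (m ℕ.+_) (ℕ.+-identityʳ m) ⟩
  m ℕ.+ m                                 ≤⟨ ℕ.+-mono-≤ (bound zero) (bound (suc zero)) ⟩
  ∣ layer-subset (suc m) zero X ∣ˢ ℕ.+ ∣ layer-subset (suc m) (suc zero) X ∣ˢ
                                          ≡⟨ ∣layers∣ (suc m) X ⟩
  ∣ X ∣ˢ                                  ∎
  where
  open ℕ.≤-Reasoning
  bound : ∀ h → m ℕ.≤ ∣ layer-subset (suc m) h X ∣ˢ
  bound h = ℕ.s≤s⁻¹ (complete-cover-size (suc m) _ (layer-cover (suc m) h X cover))

-- The complement of the two nonadjacent vertices (0 , 0) and (1 , 1).
prism-cover : ∀ k → Subset ((2 ℕ.+ k) ℕ.* 2)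
prism-cover k = outside ∷ inside ∷ inside ∷ outside ∷ ⊤

-- An uncovered edge would have both ends among the two omitted vertices, which are neither adjacent
-- to each other nor to themselves.
prism-cover-covers : ∀ k → IsVertexCover (K (2 ℕ.+ k) □ K 2) (prism-cover k)
prism-cover-covers k = covers
  where
  G : Graph
  G = K (2 ℕ.+ k) □ K 2
  member : ∀ {i} → i ∈ prism-cover k ⊎ (i ≡ zero ⊎ i ≡ suc (suc (suc zero)))
  member {zero}                    = inj₂ (inj₁ ≡.refl)
  member {suc zero}                = inj₁ (there here)
  member {suc (suc zero)}          = inj₁ (there (there here))
  member {suc (suc (suc zero))}    = inj₂ (inj₂ ≡.refl)
  member {suc (suc (suc (suc i)))} = inj₁ (there (there (there (there ∈⊤))))
  nonadjacent : ¬ Adj G zero (suc (suc (suc zero)))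
  nonadjacent (inj₁ (() , _))
  nonadjacent (inj₂ (_ , ()))
  covers : ∀ i j → Adj G i j → i ∈ prism-cover k ⊎ j ∈ prism-cover k
  covers i j i~j with member {i} | member {j}
  ... | inj₁ i∈X           | _                  = inj₁ i∈X
  ... | inj₂ _             | inj₁ j∈X           = inj₂ j∈X
  ... | inj₂ (inj₁ ≡.refl) | inj₂ (inj₂ ≡.refl) = contradiction i~j nonadjacent
  ... | inj₂ (inj₂ ≡.refl) | inj₂ (inj₁ ≡.refl) = contradiction (symm G {i} {j} i~j) nonadjacent
  ... | inj₂ (inj₁ ≡.refl) | inj₂ (inj₁ ≡.refl) = contradiction i~j (irrefl G {i} ≡.refl)
  ... | inj₂ (inj₂ ≡.refl) | inj₂ (inj₂ ≡.refl) = contradiction i~j (irrefl G {i} ≡.refl)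

∈-subsets : ∀ {n} (X : Subset n) → X ∈ˡ subsets n
∈-subsets []            = Any.here ≡.refl
∈-subsets (inside ∷ X)  = ∈-++⁺ˡ (∈-map⁺ (inside ∷_) (∈-subsets X))
∈-subsets (outside ∷ X) = ∈-++⁺ʳ (map (inside ∷_) (subsets _)) (∈-map⁺ (outside ∷_) (∈-subsets X))

τ≤ : ∀ G {X} → IsVertexCover G X → τ G ℕ.≤ ∣ X ∣ˢ
τ≤ G {X} cover = min≤v⁺ (order G) _ (inj₂ (Any.map (ℕ.≤-reflexive ∘ ≡.sym)
  (∈-map⁺ ∣_∣ˢ (∈-filter⁺ (isVertexCover? G) (∈-subsets X) cover))))

-- The bound by `order G` accounts for the default value of `min`.
≤τ : ∀ G {s} → s ℕ.≤ order G → (∀ X → IsVertexCover G X → s ℕ.≤ ∣ X ∣ˢ) → s ℕ.≤ τ G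
≤τ G s≤n s≤ = v≤min⁺ s≤n (All.map⁺ (All.map (λ {X} → s≤ X) (All.all-filter (isVertexCover? G) (subsets (order G)))))

-- Two nonadjacent vertices in different layers exist only from n = 2 on; for n = 1 the prism is a
-- single edge, with cover number 1.
τ-prism : ∀ k → τ (K (2 ℕ.+ k) □ K 2) ≡ suc k ℕ.* 2
τ-prism k = ℕ.≤-antisym
  (≡.subst (τ (K (2 ℕ.+ k) □ K 2) ℕ.≤_) (≡.cong (2 ℕ.+_) (∣⊤∣≡n (k ℕ.* 2)))
    (τ≤ (K (2 ℕ.+ k) □ K 2) (prism-cover-covers k)))
  (≤τ (K (2 ℕ.+ k) □ K 2) (ℕ.m≤n+m (suc k ℕ.* 2) 2) (prism-cover-size (suc k)))

-- Passing from Cauchy reals to rationals, one index at a time.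

pointwise⇒≈ : ∀ {a b} → (∀ k → seq a k ≡ seq b k) → a ℝ.≈ b
pointwise⇒≈ {a} {b} eq ε = 0 , λ k _ → ≡.subst (ℚ._< ε)
  (≡.cong ℚ.∣_∣ (≡.trans (≡.sym (ℚ.+-inverseʳ (seq b k))) (≡.cong (ℚ._- seq b k) (≡.sym (eq k)))))
  (ℚ.positive⁻¹ ε)

module _ {a ℓ b ℓ′} (A : RawMonoid a ℓ) (B : RawMonoid b ℓ′) where
  private
    module A = RawMonoid A
    module B = RawMonoid B

  -- Taking the term at a fixed index preserves the real operations up to propositional equality.
  -- The monoids are arbitrary so that both `∑` and `∏` are covered.
  sum-homo : (f : A.Carrier → B.Carrier) → f A.ε ≡ B.ε → (∀ x y → f (x A.∙ y) ≡ f x B.∙ f y) →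
    ∀ {n} (v : Vector A.Carrier n) {w} → (∀ i → f (v i) ≡ w i) →
    f (RawMonoidOps.sum A v) ≡ RawMonoidOps.sum B w
  sum-homo f ε-homo ∙-homo {zero}  v v≡w = ε-homo
  sum-homo f ε-homo ∙-homo {suc n} v v≡w = ≡.trans (∙-homo _ _)
    (≡.cong₂ B._∙_ (v≡w zero) (sum-homo f ε-homo ∙-homo (v ∘ suc) (v≡w ∘ suc)))

module _ {a ℓ b ℓ′} (R : RawRing a ℓ) (S : RawRing b ℓ′) (f : RawRing.Carrier R → RawRing.Carrier S) where
  private
    module R = RawRing R
    module S = RawRing S
    module R^ = RawSemiringOps R.rawSemiring
    module S^ = RawSemiringOps S.rawSemiring

  module _
    (0-homo : f R.0# ≡ S.0#) (1-homo : f R.1# ≡ S.1#) (neg-homo : ∀ x → f (R.- x) ≡ S.- f x)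
    (+-homo : ∀ x y → f (x R.+ y) ≡ f x S.+ f y) (*-homo : ∀ x y → f (x R.* y) ≡ f x S.* f y)
    where
    open ≡.≡-Reasoning

    ^-homo : ∀ x n → f (x R^.^ n) ≡ f x S^.^ n
    ^-homo x zero    = 1-homo
    ^-homo x (suc n) = ≡.trans (*-homo _ _) (≡.cong (f x S.*_) (^-homo x n))

    det-homo : ∀ {n} (M : Fin n → Fin n → R.Carrier) → f (det R M) ≡ det S (λ i j → f (M i j))
    det-homo {zero}  M = 1-homo
    det-homo {suc n} M = sum-homo R.+-rawMonoid S.+-rawMonoid f 0-homo +-homo _ λ j → begin
      f (((R.- R.1#) R^.^ toℕ j) R.* M zero j R.* det R (minorᴿ j))
        ≡⟨ ≡.trans (*-homo _ _) (≡.cong (S._* f (det R (minorᴿ j))) (*-homo _ _)) ⟩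
      f ((R.- R.1#) R^.^ toℕ j) S.* f (M zero j) S.* f (det R (minorᴿ j))
        ≡⟨ ≡.cong₂ (λ s d → s S.* f (M zero j) S.* d)
             (≡.trans (^-homo _ (toℕ j)) (≡.cong (S^._^ toℕ j) (≡.trans (neg-homo _) (≡.cong S.-_ 1-homo))))
             (det-homo (minorᴿ j)) ⟩
      ((S.- S.1#) S^.^ toℕ j) S.* f (M zero j) S.* det S (λ i l → f (minorᴿ j i l)) ∎
      where
      minorᴿ : Fin (suc n) → Fin n → Fin n → R.Carrier
      minorᴿ j i l = M (suc i) (punchIn j l)

seq-det : ∀ {n} (M : Matrix n) k →
  seq (det ℝ-rawRing M) k ≡ Determinant.∣_∣ ℚ.+-*-commutativeRing (λ i j → seq (M i j) k)
seq-det M k = det-homo ℝ-rawRing ℚ.+-*-rawRing (λ x → seq x k)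
  ≡.refl ≡.refl (λ _ → ≡.refl) (λ _ _ → ≡.refl) (λ _ _ → ≡.refl) M

open import Algebra.Definitions.RawMonoid ℚ.+-0-rawMonoid using (sum) renaming (_×_ to _×ℚ_)
open import Algebra.Definitions.RawMonoid ℚ.*-1-rawMonoid using () renaming (sum to product)

seq-∑ : ∀ {n} (v : Vector ℝ n) {k w} → (∀ i → seq (v i) k ≡ w i) → seq (∑ v) k ≡ sum w
seq-∑ v {k} = sum-homo (RawRing.+-rawMonoid ℝ-rawRing) ℚ.+-0-rawMonoid (λ x → seq x k) ≡.refl (λ _ _ → ≡.refl) v

seq-∏ : ∀ {n} (v : Vector ℝ n) {k w} → (∀ i → seq (v i) k ≡ w i) → seq (∏ v) k ≡ product w
seq-∏ v {k} = sum-homo (RawRing.*-rawMonoid ℝ-rawRing) ℚ.*-1-rawMonoid (λ x → seq x k) ≡.refl (λ _ _ → ≡.refl) v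

seq-if : ∀ b p q k → seq (if b then fromℚ p else fromℚ q) k ≡ (if b then p else q)
seq-if true  p q k = ≡.refl
seq-if false p q k = ≡.refl

open Determinant ℚ.+-*-commutativeRing using (∣_∣; det-cong)

module _ (G : Graph) (es : Vector ℝ (order G)) (e : Vector ℚ (order G))
  (es≡e : ∀ i k → seq (es i) k ≡ e i) where
  open ≡.≡-Reasoning

  -- At index k a real argument x becomes the rational q = `seq x k`, so the identity at all
  -- rationals gives it at all reals.
  rational-spectrum :
    (∀ q → ∣ charMatrix G q ∣ ≡ product (λ i → q ℚ.- e i)) →
    IsSpectrum (adjacency G) es
  rational-spectrum charPoly≡ x = pointwise⇒≈ {charPoly (adjacency G) x} {∏ (λ i → x ℝ.- es i)} λ k →
    let q = seq x k in begin
    seq (charPoly (adjacency G) x) k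
      ≡⟨ seq-det (λ i j → x ℝ.* 𝟙 i j ℝ.- adjacency G i j) k ⟩
    ∣ (λ i j → q ℚ.* seq (𝟙 i j) k ℚ.- seq (adjacency G i j) k) ∣
      ≡⟨ det-cong (λ i j → ≡.cong₂ (λ s t → q ℚ.* s ℚ.- t)
           (seq-if (does (i ≟ j)) 1ℚ 0ℚ k) (seq-if (does (adj? G i j)) 1ℚ 0ℚ k)) ⟩
    ∣ charMatrix G q ∣
      ≡⟨ charPoly≡ q ⟩
    product (λ i → q ℚ.- e i)
      ≡⟨ seq-∏ (λ i → x ℝ.- es i) (λ i → ≡.cong (λ y → q ℚ.- y) (es≡e i k)) ⟨
    seq (∏ (λ i → x ℝ.- es i)) k ∎

  rational-energy : ∀ k →
    (∀ q → ∣ charMatrix G q ∣ ≡ product (λ i → q ℚ.- e i)) →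
    ℤ.+ k ℚ./ 1 ≡ sum (λ i → ℚ.∣ e i ∣) → IsEnergy G (fromℕ k)
  rational-energy k charPoly≡ ∑∣e∣ = es , rational-spectrum charPoly≡ ,
    pointwise⇒≈ {fromℕ k} {∑ (λ i → abs (es i))} λ k →
      ≡.trans ∑∣e∣ (≡.sym (seq-∑ (λ i → abs (es i)) (λ i → ≡.cong ℚ.∣_∣ (es≡e i k))))

-- Spectrum and energy of the prism.

open Prism using (blocks; det-blocks; det-xI-A)

-- The roots of x(x + 2). Each diagonal block contributes both, and the layer serves only as an
-- index for them.
layerEigenvalue : Fin 2 → ℚ
layerEigenvalue zero       = 0ℚ
layerEigenvalue (suc zero) = ℚ.- (1ℚ ℚ.+ 1ℚ)

eigenvalue : ∀ m → Vector ℚ (suc m ℕ.* 2)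
eigenvalue m zero          = suc m ×ℚ 1ℚ
eigenvalue m (suc zero)    = suc m ×ℚ 1ℚ ℚ.- (1ℚ ℚ.+ 1ℚ)
eigenvalue m (suc (suc i)) = layerEigenvalue (remainder {m} 2 i)

det-blocks≡product : ∀ m q → ∣ blocks q m ∣ ≡ product (λ i → q ℚ.- layerEigenvalue (remainder {m} 2 i))
det-blocks≡product zero    q = ≡.refl
det-blocks≡product (suc m) q = ≡.trans (det-blocks q m)
  (≡.cong (λ d → (q ℚ.- 0ℚ) ℚ.* ((q ℚ.+ (1ℚ ℚ.+ 1ℚ)) ℚ.* d)) (det-blocks≡product m q))

prism-charPoly : ∀ m q → ∣ charMatrix (K (suc m) □ K 2) q ∣ ≡ product (λ i → q ℚ.- eigenvalue m i)
prism-charPoly m q = ≡.trans (det-xI-A q m)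
  (≡.cong (λ d → (q ℚ.- c) ℚ.* ((q ℚ.- (c ℚ.- (1ℚ ℚ.+ 1ℚ))) ℚ.* d)) (det-blocks≡product m q))
  where
  c : ℚ
  c = suc m ×ℚ 1ℚ

module _ where
  open ≡.≡-Reasoning
  open ℚ-Solver

  /1≡× : ∀ n → ℤ.+ n ℚ./ 1 ≡ n ×ℚ 1ℚ
  /1≡× zero    = ≡.refl
  /1≡× (suc n) = begin
    ℤ.+ suc n ℚ./ 1
      -- Adding 1 and n / 1, both in lowest terms, unfolds to the fraction with numerator 1 + n · 1,
      -- so the numerator is brought to that form.
      ≡⟨ ℚ./-cong {q₁ = 1} {p₂ = ℤ.+ 1 ℤ.+ ℤ.+ n ℤ.* ℤ.+ 1} {q₂ = 1}
           (≡.cong (ℤ._+_ (ℤ.+ 1)) (≡.sym (ℤ.*-identityʳ (ℤ.+ n)))) ≡.refl ⟩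
    1ℚ ℚ.+ ℚ.mkℚ (ℤ.+ n) 0 n⊥1
      ≡⟨ ≡.cong (1ℚ ℚ.+_) (≡.trans (≡.sym (ℚ.normalize-coprime n⊥1)) (/1≡× n)) ⟩
    1ℚ ℚ.+ n ×ℚ 1ℚ ∎
    where
    n⊥1 : Coprime n 1
    n⊥1 = Coprime.sym (1-coprimeTo n)

  ×-nonneg : ∀ n → 0ℚ ℚ.≤ n ×ℚ 1ℚ
  ×-nonneg zero    = ℚ.≤-refl
  ×-nonneg (suc n) = ℚ.+-mono-≤ {0ℚ} {1ℚ} (ℚ.<⇒≤ (ℚ.positive⁻¹ 1ℚ)) (×-nonneg n)

  *2×≡ : ∀ n → (n ℕ.* 2) ×ℚ 1ℚ ≡ n ×ℚ 1ℚ ℚ.+ n ×ℚ 1ℚ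
  *2×≡ zero    = ≡.refl
  *2×≡ (suc n) = ≡.trans (≡.cong (λ s → 1ℚ ℚ.+ (1ℚ ℚ.+ s)) (*2×≡ n))
    (solve 1 (λ a → con 1ℚ :+ (con 1ℚ :+ (a :+ a)) := con 1ℚ :+ a :+ (con 1ℚ :+ a)) ≡.refl (n ×ℚ 1ℚ))

  ∑-∣layerEigenvalue∣ : ∀ m →
    sum (λ i → ℚ.∣ layerEigenvalue (remainder {m} 2 i) ∣) ≡ (m ℕ.* 2) ×ℚ 1ℚ
  ∑-∣layerEigenvalue∣ zero    = ≡.refl
  ∑-∣layerEigenvalue∣ (suc m) = ≡.trans
    (≡.cong (λ s → 0ℚ ℚ.+ (1ℚ ℚ.+ 1ℚ ℚ.+ s)) (∑-∣layerEigenvalue∣ m))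
    (solve 1 (λ s → con 0ℚ :+ (con 1ℚ :+ con 1ℚ :+ s) := con 1ℚ :+ (con 1ℚ :+ s)) ≡.refl ((m ℕ.* 2) ×ℚ 1ℚ))

  prism-energy : ∀ m → ℤ.+ (2 ℕ.* τ (K (suc m) □ K 2)) ℚ./ 1 ≡
    sum (λ i → ℚ.∣ eigenvalue m i ∣)
  -- For n = 1 the eigenvalues are 1 and -1 and the cover number is 1, checked by evaluation; only
  -- here is n - 2 negative.
  prism-energy zero    = ≡.refl
  prism-energy (suc m) = begin
    ℤ.+ (2 ℕ.* τ (K (2 ℕ.+ m) □ K 2)) ℚ./ 1
      ≡⟨ ≡.cong (λ t → ℤ.+ (2 ℕ.* t) ℚ./ 1) (τ-prism m) ⟩
    ℤ.+ (2 ℕ.* (suc m ℕ.* 2)) ℚ./ 1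
      ≡⟨ /1≡× (2 ℕ.* (suc m ℕ.* 2)) ⟩
    (2 ℕ.* (suc m ℕ.* 2)) ×ℚ 1ℚ
      ≡⟨ ≡.cong (_×ℚ 1ℚ) (ℕ.*-comm 2 (suc m ℕ.* 2)) ⟩
    (suc m ℕ.* 2 ℕ.* 2) ×ℚ 1ℚ
      ≡⟨ *2×≡ (suc m ℕ.* 2) ⟩
    (suc m ℕ.* 2) ×ℚ 1ℚ ℚ.+ (suc m ℕ.* 2) ×ℚ 1ℚ
      ≡⟨ ≡.cong (ℚ._+ (suc m ℕ.* 2) ×ℚ 1ℚ) (*2×≡ (suc m)) ⟩
    1ℚ ℚ.+ ι ℚ.+ (1ℚ ℚ.+ ι) ℚ.+ (suc m ℕ.* 2) ×ℚ 1ℚ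
      ≡⟨ solve 2 (λ a s → con 1ℚ :+ a :+ (con 1ℚ :+ a) :+ s := con 1ℚ :+ (con 1ℚ :+ a) :+ (a :+ s))
           ≡.refl ι ((suc m ℕ.* 2) ×ℚ 1ℚ) ⟩
    c ℚ.+ (ι ℚ.+ (suc m ℕ.* 2) ×ℚ 1ℚ)
      -- Here n = m + 2, so both n and n - 2 = m are nonnegative and equal their absolute values.
      ≡⟨ ≡.cong₂ (λ p q → p ℚ.+ (q ℚ.+ (suc m ℕ.* 2) ×ℚ 1ℚ))
           (≡.sym (ℚ.0≤p⇒∣p∣≡p (×-nonneg (2 ℕ.+ m))))
           (≡.trans (≡.sym (ℚ.0≤p⇒∣p∣≡p (×-nonneg m))) (≡.cong ℚ.∣_∣ ι≡c-2)) ⟩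
    ℚ.∣ c ∣ ℚ.+ (ℚ.∣ c ℚ.- (1ℚ ℚ.+ 1ℚ) ∣ ℚ.+ (suc m ℕ.* 2) ×ℚ 1ℚ)
      ≡⟨ ≡.cong (λ s → ℚ.∣ c ∣ ℚ.+ (ℚ.∣ c ℚ.- (1ℚ ℚ.+ 1ℚ) ∣ ℚ.+ s)) (∑-∣layerEigenvalue∣ (suc m)) ⟨
    sum (λ i → ℚ.∣ eigenvalue (suc m) i ∣) ∎
    where
    ι c : ℚ
    ι = m ×ℚ 1ℚ
    c = (2 ℕ.+ m) ×ℚ 1ℚ
    ι≡c-2 : ι ≡ c ℚ.- (1ℚ ℚ.+ 1ℚ)
    ι≡c-2 = solve 1 (λ a → a := con 1ℚ :+ (con 1ℚ :+ a) :- (con 1ℚ :+ con 1ℚ)) ≡.refl ι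

open import Data.Nat.Base using (_*_)

theorem3p7 : (n : ℕ) → .{{_ : NonZero n}} →
    IsEnergy (K n □ K 2) (fromℕ (2 * τ (K n □ K 2)))
theorem3p7 zero    = contradiction ≡.refl (ℕ.≢-nonZero⁻¹ 0)
theorem3p7 (suc m) = rational-energy (K (suc m) □ K 2)
  (λ i → fromℚ (eigenvalue m i)) (eigenvalue m) (λ _ _ → ≡.refl)
  (2 * τ (K (suc m) □ K 2)) (prism-charPoly m) (prism-energy m)
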